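{- For any fixed $\varepsilon>0$ and any prime number $p$, the set $$\{xy\pmod p:\ 1\le x,y\le p^{1/2}(\log p)^{2+\varepsilon}\}$$ (with $x,y$ integers) contains $(1+o(1))p$ residue classes modulo $p$, as $p\to\infty$.
   Context: Here $o(1)$ denotes a quantity tending to $0$ as the prime $p$ tends to infinity, with $\varepsilon$ fixed. -}

module Defs where

open import Algebra.Bundles using (CommutativeRing)
open import Data.Fin.Base using (Fin; toℕ)
import Data.Fin.Base as Fin
open import Data.Integer.Base as ℤ using (+_; ∣_∣)
import Data.Integer.Properties as ℤₚ
open import Data.Integer.Solver using (module +-*-Solver)
open import Data.List.Base using (length)
open import Data.List.Relation.Unary.All using (All)
open import Data.List.Relation.Unary.Unique.Propositional using (Unique)
open import Data.Nat.Base as ℕ using (ℕ; zero; suc; NonZero)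
open import Data.Nat.DivMod using (_mod_)
import Data.Nat.Properties as ℕₚ
open import Data.Product.Base using (∃; ∃-syntax; _×_; _,_; proj₁; proj₂)
open import Data.Rational.Base as ℚ using (ℚ; 0ℚ; 1ℚ; ½; mkℚ; _/_; ↥_; ↧ₙ_; *≤*; *<*)
import Data.Rational.Properties as ℚₚ
import Data.Rational.Unnormalised.Base as ℚᵘ
import Data.Rational.Unnormalised.Properties as ℚᵘₚ
open import Data.Sum.Base using (_⊎_; inj₁; inj₂)
open import Function.Base using (_∘_)
open import Relation.Binary.PropositionalEquality
open import Relation.Nullary using (¬_; yes; no)

open import Algebra.Properties.Semiring.Exp
  (CommutativeRing.semiring ℚₚ.+-*-commutativeRing) as ℚ^
  using () renaming (_^_ to _^ℚ_)
open import Algebra.Definitions.RawMonoid ℚ.+-0-rawMonoid using () renaming (sum to sumℚ)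

fromℕ : ℕ → ℚ
fromℕ n = + n / 1

-- Real numbers as Dedekind cuts, each cut being given by its lower part:
-- α is represented by { q ∈ ℚ | q < α }.

record ℝ : Set₁ where
  field
    lower     : ℚ → Set
    inhabited : ∃ lower
    bounded   : ∃[ u ] ¬ lower u
    closed    : ∀ {q r} → q ℚ.< r → lower r → lower q
    rounded   : ∀ {q} → lower q → ∃[ r ] (q ℚ.< r × lower r)

infix 4 _∈_ _∉_ _≤_ _<_

_∈_ _∉_ : ℚ → ℝ → Set
q ∈ α = ℝ.lower α q
q ∉ α = ¬ (q ∈ α)

_≤_ _<_ : ℝ → ℝ → Set
α ≤ β = ∀ {q} → q ∈ α → q ∈ β
α < β = ∃[ q ] (q ∈ β × q ∉ α)

∈∉⇒< : ∀ α {q u} → q ∈ α → u ∉ α → q ℚ.< u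
∈∉⇒< α {q} {u} q∈α u∉α = ℚₚ.≰⇒> λ u≤q → u∉α (down u≤q)
  where
  down : u ℚ.≤ q → u ∈ α
  down u≤q with u ℚₚ.<? q
  ... | yes u<q = ℝ.closed α u<q q∈α
  ... | no  u≮q = subst (_∈ α) (ℚₚ.≤-antisym (ℚₚ.≮⇒≥ u≮q) u≤q) q∈α

private
  below : ∀ r → ∃[ q ] q ℚ.< r
  below r = r ℚ.+ (ℚ.- 1ℚ) , subst (r ℚ.+ (ℚ.- 1ℚ) ℚ.<_) (ℚₚ.+-identityʳ r)
    (ℚₚ.+-monoʳ-< r (*<* ℤ.-<+))

  dense : ∀ {q r} → q ℚ.< r → ∃[ s ] (q ℚ.< s × s ℚ.< r)
  dense = ℚₚ.<-dense

  <⇒≱ : ∀ {q r} → q ℚ.< r → ¬ (r ℚ.≤ q)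
  <⇒≱ q<r r≤q = ℚₚ.<-irrefl refl (ℚₚ.<-≤-trans q<r r≤q)

  *-mono-≤ : ∀ {a b c d} → 0ℚ ℚ.≤ c → 0ℚ ℚ.≤ b →
             a ℚ.≤ b → c ℚ.≤ d → a ℚ.* c ℚ.≤ b ℚ.* d
  *-mono-≤ {a} {b} {c} {d} 0≤c 0≤b a≤b c≤d = ℚₚ.≤-trans
    (ℚₚ.*-monoʳ-≤-nonNeg c {{ℚ.nonNegative 0≤c}} a≤b)
    (ℚₚ.*-monoˡ-≤-nonNeg b {{ℚ.nonNegative 0≤b}} c≤d)

  0≤1 : 0ℚ ℚ.≤ 1ℚ
  0≤1 = *≤* (ℤ.+≤+ ℕ.z≤n)

  0≤^ : ∀ {a} n → 0ℚ ℚ.≤ a → 0ℚ ℚ.≤ a ^ℚ n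
  0≤^ zero 0≤a = 0≤1
  0≤^ {a} (suc n) 0≤a = ℚₚ.≤-trans (ℚₚ.≤-reflexive (sym (ℚₚ.*-zeroˡ 0ℚ)))
    (*-mono-≤ ℚₚ.≤-refl 0≤a 0≤a (0≤^ n 0≤a))

  1≤^ : ∀ {a} n → 1ℚ ℚ.≤ a → 1ℚ ℚ.≤ a ^ℚ n
  1≤^ zero 1≤a = ℚₚ.≤-refl
  1≤^ {a} (suc n) 1≤a = *-mono-≤ 0≤1 (ℚₚ.≤-trans 0≤1 1≤a) 1≤a (1≤^ n 1≤a)

  ^-monoˡ-≤ : ∀ {a b} n → 0ℚ ℚ.≤ a → a ℚ.≤ b → a ^ℚ n ℚ.≤ b ^ℚ n
  ^-monoˡ-≤ zero 0≤a a≤b = ℚₚ.≤-refl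
  ^-monoˡ-≤ (suc n) 0≤a a≤b =
    *-mono-≤ (0≤^ n 0≤a) (ℚₚ.≤-trans 0≤a a≤b) a≤b (^-monoˡ-≤ n 0≤a a≤b)

  ^-monoˡ-< : ∀ {a b} n → 0ℚ ℚ.< a → a ℚ.< b → a ^ℚ suc n ℚ.< b ^ℚ suc n
  ^-monoˡ-< {a} {b} n 0<a a<b = ℚₚ.<-≤-trans
    (ℚₚ.*-monoˡ-<-pos (a ^ℚ n) {{ℚ.positive (0<^ n)}} a<b)
    (ℚₚ.*-monoˡ-≤-nonNeg b {{ℚ.nonNegative (ℚₚ.<⇒≤ (ℚₚ.<-trans 0<a a<b))}}
      (^-monoˡ-≤ n (ℚₚ.<⇒≤ 0<a) (ℚₚ.<⇒≤ a<b)))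
    where
    0<^ : ∀ k → 0ℚ ℚ.< a ^ℚ k
    0<^ zero    = *<* (ℤ.+<+ (ℕ.s≤s ℕ.z≤n))
    0<^ (suc k) = subst (ℚ._< a ℚ.* a ^ℚ k) (ℚₚ.*-zeroˡ (a ^ℚ k))
      (ℚₚ.*-monoˡ-<-pos (a ^ℚ k) {{ℚ.positive (0<^ k)}} 0<a)

  ^-monoʳ-≤ : ∀ {a m n} → 1ℚ ℚ.≤ a → m ℕ.≤ n → a ^ℚ m ℚ.≤ a ^ℚ n
  ^-monoʳ-≤ {n = n} 1≤a ℕ.z≤n = 1≤^ n 1≤a
  ^-monoʳ-≤ {a} {suc m} 1≤a (ℕ.s≤s m≤n) =
    *-mono-≤ (0≤^ m 0≤a) 0≤a ℚₚ.≤-refl (^-monoʳ-≤ 1≤a m≤n)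
    where 0≤a = ℚₚ.≤-trans 0≤1 1≤a

  ^≤1 : ∀ {a} n → 0ℚ ℚ.≤ a → a ℚ.≤ 1ℚ → a ^ℚ n ℚ.≤ 1ℚ
  ^≤1 n 0≤a a≤1 = ℚₚ.≤-trans (^-monoˡ-≤ n 0≤a a≤1) (ℚₚ.≤-reflexive (1^ n))
    where
    1^ : ∀ k → 1ℚ ^ℚ k ≡ 1ℚ
    1^ zero    = refl
    1^ (suc k) = trans (ℚₚ.*-identityˡ _) (1^ k)

fromℚ : ℚ → ℝ
fromℚ r = record
  { lower     = ℚ._< r
  ; inhabited = below r
  ; bounded   = r , ℚₚ.<-irrefl refl
  ; closed    = ℚₚ.<-trans
  ; rounded   = dense
  }

0ℝ : ℝ
0ℝ = fromℚ 0ℚ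

infixl 6 _+_
infixl 7 _*_
infixr 8 _^_

_+_ : ℝ → ℝ → ℝ
α + β = record
  { lower     = λ q → ∃[ r ] ∃[ s ] (r ∈ α × s ∈ β × q ℚ.< r ℚ.+ s)
  ; inhabited = let r , r∈α = ℝ.inhabited α
                    s , s∈β = ℝ.inhabited β
                    q , q<  = below (r ℚ.+ s)
                in q , r , s , r∈α , s∈β , q<
  ; bounded   = let u , u∉α = ℝ.bounded α
                    v , v∉β = ℝ.bounded β
                in u ℚ.+ v , λ (r , s , r∈α , s∈β , lt) → ℚₚ.<-asym lt
                     (ℚₚ.+-mono-< (∈∉⇒< α r∈α u∉α) (∈∉⇒< β s∈β v∉β))
  ; closed    = λ q<q′ (r , s , r∈α , s∈β , lt) →
                  r , s , r∈α , s∈β , ℚₚ.<-trans q<q′ lt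
  ; rounded   = λ (r , s , r∈α , s∈β , lt) →
                  let q′ , q<q′ , q′< = dense lt
                  in q′ , q<q′ , r , s , r∈α , s∈β , q′<
  }

-- The product of α and β for 0 ≤ α and 0 ≤ β (the only case used).
_*_ : ℝ → ℝ → ℝ
α * β = record
  { lower     = Lower
  ; inhabited = let q , q<0 = below 0ℚ in q , inj₁ q<0
  ; bounded   = let u , u∉α = ℝ.bounded α
                    v , v∉β = ℝ.bounded β
                    U = 0ℚ ℚ.⊔ u
                    V = 0ℚ ℚ.⊔ v
                    0≤U = ℚₚ.p≤p⊔q 0ℚ u
                    0≤V = ℚₚ.p≤p⊔q 0ℚ v
                in U ℚ.* V , λ where
                     (inj₁ UV<0) → <⇒≱ UV<0 (ℚₚ.≤-trans
                       (ℚₚ.≤-reflexive (sym (ℚₚ.*-zeroˡ 0ℚ)))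
                       (*-mono-≤ ℚₚ.≤-refl 0≤U 0≤U 0≤V))
                     (inj₂ (r , s , r∈α , s∈β , 0≤r , 0≤s , lt)) →
                       <⇒≱ lt (*-mono-≤ 0≤s 0≤U
                         (ℚₚ.≤-trans (ℚₚ.<⇒≤ (∈∉⇒< α r∈α u∉α)) (ℚₚ.p≤q⊔p 0ℚ u))
                         (ℚₚ.≤-trans (ℚₚ.<⇒≤ (∈∉⇒< β s∈β v∉β)) (ℚₚ.p≤q⊔p 0ℚ v)))
  ; closed    = λ where
                  q<q′ (inj₁ q′<0) → inj₁ (ℚₚ.<-trans q<q′ q′<0)
                  q<q′ (inj₂ (r , s , r∈α , s∈β , 0≤r , 0≤s , lt)) →
                    inj₂ (r , s , r∈α , s∈β , 0≤r , 0≤s , ℚₚ.<-trans q<q′ lt)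
  ; rounded   = λ where
                  (inj₁ q<0) → let q′ , q<q′ , q′<0 = dense q<0
                               in q′ , q<q′ , inj₁ q′<0
                  (inj₂ (r , s , r∈α , s∈β , 0≤r , 0≤s , lt)) →
                    let q′ , q<q′ , q′< = dense lt
                    in q′ , q<q′ , inj₂ (r , s , r∈α , s∈β , 0≤r , 0≤s , q′<)
  }
  where
  Lower : ℚ → Set
  Lower q = q ℚ.< 0ℚ ⊎
    ∃[ r ] ∃[ s ] (r ∈ α × s ∈ β × 0ℚ ℚ.≤ r × 0ℚ ℚ.≤ s × q ℚ.< r ℚ.* s)

-- α ^ β is the supremum of the numbers b ^ t with b and t rational and
-- 0 < b < α, where t < β if 1 ≤ b, and t ≥ β if b < 1 (b ^ t decreases in t
-- in that case).  For t = m / n in lowest terms, c ≤ b ^ t is the inequality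
-- c ^ n ≤ b ^ m between rationals.
record InPower (α β : ℝ) (q : ℚ) : Set where
  field
    b c t  : ℚ
    0<b    : 0ℚ ℚ.< b
    b∈α    : b ∈ α
    0≤t    : 0ℚ ℚ.≤ t
    t-side : (1ℚ ℚ.≤ b × t ∈ β) ⊎ (b ℚ.< 1ℚ × t ∉ β)
    0≤c    : 0ℚ ℚ.≤ c
    c≤b^t  : c ^ℚ (↧ₙ t) ℚ.≤ b ^ℚ ∣ ↥ t ∣
    q<c    : q ℚ.< c

private
  num≤ : ∀ t v → 0ℚ ℚ.≤ t → t ℚ.< v → ∣ ↥ t ∣ ℕ.≤ ∣ ↥ v ∣ ℕ.* ↧ₙ t
  num≤ (mkℚ (+ a) b _) (mkℚ c d _) 0≤t (*<* lt) = ℕₚ.≤-trans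
    (ℕₚ.m≤m*n a (suc d))
    (ℤₚ.drop‿+≤+ (ℤₚ.≤-trans (ℤₚ.≤-reflexive (ℤₚ.pos-* a (suc d)))
      (ℤₚ.≤-trans (ℤₚ.<⇒≤ lt)
        (ℤₚ.≤-trans (ℤₚ.*-monoʳ-≤-nonNeg (+ suc b) (i≤∣i∣ c))
          (ℤₚ.≤-reflexive (sym (ℤₚ.pos-* ∣ c ∣ (suc b))))))))
    where
    i≤∣i∣ : ∀ i → i ℤ.≤ + ∣ i ∣
    i≤∣i∣ (+ n)       = ℤₚ.≤-refl
    i≤∣i∣ ℤ.-[1+ n ] = ℤ.-≤+
  num≤ (mkℚ ℤ.-[1+ a ] b _) v (*≤* ()) lt

  root-≤ : ∀ {c w} n → 1ℚ ℚ.≤ w → c ^ℚ suc n ℚ.≤ w ^ℚ suc n → c ℚ.≤ w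
  root-≤ n 1≤w c^≤w^ = ℚₚ.≮⇒≥ λ w<c → <⇒≱
    (^-monoˡ-< n (ℚₚ.<-≤-trans (*<* (ℤ.+<+ (ℕ.s≤s ℕ.z≤n))) 1≤w) w<c) c^≤w^

  power-bounded : ∀ α β → ∃[ w ] (0ℚ ℚ.≤ w × ¬ InPower α β w)
  power-bounded α β =
    w , ℚₚ.≤-trans 0≤1 1≤w , λ P → <⇒≱ (InPower.q<c P) (c≤w P)
    where
    u = proj₁ (ℝ.bounded α)
    u∉α = proj₂ (ℝ.bounded α)
    v = proj₁ (ℝ.bounded β)
    v∉β = proj₂ (ℝ.bounded β)
    U = 1ℚ ℚ.⊔ u
    K = ∣ ↥ v ∣
    w = U ^ℚ K
    1≤U : 1ℚ ℚ.≤ U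
    1≤U = ℚₚ.p≤p⊔q 1ℚ u
    1≤w : 1ℚ ℚ.≤ w
    1≤w = 1≤^ K 1≤U

    c≤w : ∀ {q} (P : InPower α β q) → InPower.c P ℚ.≤ w
    c≤w record { b = b ; t = t@(mkℚ _ d _) ; 0<b = 0<b ; b∈α = b∈α ; 0≤t = 0≤t
               ; t-side = inj₁ (1≤b , t∈β) ; c≤b^t = c≤b^t } =
      root-≤ d 1≤w (ℚₚ.≤-trans c≤b^t (ℚₚ.≤-trans
        (^-monoˡ-≤ ∣ ↥ t ∣ (ℚₚ.<⇒≤ 0<b)
          (ℚₚ.≤-trans (ℚₚ.<⇒≤ (∈∉⇒< α b∈α u∉α)) (ℚₚ.p≤q⊔p 1ℚ u)))
        (ℚₚ.≤-trans (^-monoʳ-≤ 1≤U (num≤ t v 0≤t (∈∉⇒< β t∈β v∉β)))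
          (ℚₚ.≤-reflexive (sym (ℚ^.^-assocʳ U K (suc d)))))))
    c≤w record { b = b ; t = t@(mkℚ _ d _) ; 0<b = 0<b
               ; t-side = inj₂ (b<1 , _) ; c≤b^t = c≤b^t } =
      root-≤ d 1≤w (ℚₚ.≤-trans c≤b^t (ℚₚ.≤-trans
        (^≤1 ∣ ↥ t ∣ (ℚₚ.<⇒≤ 0<b) (ℚₚ.<⇒≤ b<1)) (1≤^ (suc d) 1≤w)))

-- The power α ^ β for 0 < α and 0 ≤ β (the only case used).
_^_ : ℝ → ℝ → ℝ
α ^ β = record
  { lower     = λ q → q ℚ.< 0ℚ ⊎ InPower α β q
  ; inhabited = let q , q<0 = below 0ℚ in q , inj₁ q<0
  ; bounded   = let w , 0≤w , w∉ = power-bounded α β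
                in w , λ where
                     (inj₁ w<0) → <⇒≱ w<0 0≤w
                     (inj₂ w∈)  → w∉ w∈
  ; closed    = λ where
                  q<q′ (inj₁ q′<0) → inj₁ (ℚₚ.<-trans q<q′ q′<0)
                  q<q′ (inj₂ P) → inj₂ record
                    { InPower P ; q<c = ℚₚ.<-trans q<q′ (InPower.q<c P) }
  ; rounded   = λ where
                  (inj₁ q<0) → let q′ , q<q′ , q′<0 = dense q<0
                               in q′ , q<q′ , inj₁ q′<0
                  (inj₂ P) → let q′ , q<q′ , q′<c = dense (InPower.q<c P)
                             in q′ , q<q′ , inj₂ record { InPower P ; q<c = q′<c }
  }

-- The lower Riemann sum of ∫ dx / x over [1 , 1 + m], for the partition into
-- n = k + 1 intervals of length m / n: the sum over 1 ≤ i ≤ n of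
-- (m / n) · 1 / (1 + i m / n) = m / (n + i m).
lowerSum : (m k : ℕ) → ℚ
lowerSum m k = sumℚ {suc k} λ i → + m / (suc k ℕ.+ suc (toℕ i) ℕ.* m)

private
  toℚᵘ-/ : ∀ a k → ℚ.toℚᵘ (+ a / suc k) ℚᵘ.≃ ℚᵘ.mkℚᵘ (+ a) k
  toℚᵘ-/ a k = ℚₚ.toℚᵘ-fromℚᵘ (ℚᵘ.mkℚᵘ (+ a) k)

  /-anti : ∀ m k j → + m / (suc k ℕ.+ j) ℚ.≤ + m / suc k
  /-anti m k j = ℚₚ.toℚᵘ-cancel-≤
    (ℚᵘₚ.≤-trans (ℚᵘₚ.≤-reflexive (toℚᵘ-/ m (k ℕ.+ j)))
    (ℚᵘₚ.≤-trans
      (ℚᵘ.*≤* (ℤₚ.*-monoˡ-≤-nonNeg (+ m) (ℤ.+≤+ (ℕₚ.m≤m+n (suc k) j))))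
    (ℚᵘₚ.≤-reflexive (ℚᵘₚ.≃-sym (toℚᵘ-/ m k)))))

  /-homo-+ : ∀ a b k → + a / suc k ℚ.+ + b / suc k ≡ + (a ℕ.+ b) / suc k
  /-homo-+ a b k = ℚₚ.toℚᵘ-injective
    (ℚᵘₚ.≃-trans (ℚₚ.toℚᵘ-homo-+ (+ a / suc k) (+ b / suc k))
    (ℚᵘₚ.≃-trans (ℚᵘₚ.+-cong (toℚᵘ-/ a k) (toℚᵘ-/ b k))
    (ℚᵘₚ.≃-trans (ℚᵘ.*≡* (distrib (+ a) (+ b) (+ suc k)))
    (ℚᵘₚ.≃-sym (toℚᵘ-/ (a ℕ.+ b) k)))))
    where
    open +-*-Solver
    distrib : ∀ a b n → (a ℤ.* n ℤ.+ b ℤ.* n) ℤ.* n ≡ (a ℤ.+ b) ℤ.* (n ℤ.* n)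
    distrib = solve 3 (λ a b n →
      (a :* n :+ b :* n) :* n := (a :+ b) :* (n :* n)) refl

  sum-≤ : ∀ m k j (f : Fin j → ℚ) → (∀ i → f i ℚ.≤ + m / suc k) →
          sumℚ f ℚ.≤ + (j ℕ.* m) / suc k
  sum-≤ m k zero f f≤ = ℚₚ.≤-reflexive (sym (ℚₚ.0/n≡0 (suc k)))
  sum-≤ m k (suc j) f f≤ = ℚₚ.≤-trans
    (ℚₚ.+-mono-≤ (f≤ Fin.zero) (sum-≤ m k j (f ∘ Fin.suc) (f≤ ∘ Fin.suc)))
    (ℚₚ.≤-reflexive (/-homo-+ m (j ℕ.* m) k))

  cancel-/ : ∀ m k → + (suc k ℕ.* m) / suc k ≡ fromℕ m
  cancel-/ m k = ℚₚ.toℚᵘ-injective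
    (ℚᵘₚ.≃-trans (toℚᵘ-/ (suc k ℕ.* m) k)
    (ℚᵘₚ.≃-trans (ℚᵘ.*≡* (trans (ℤₚ.*-identityʳ (+ (suc k ℕ.* m)))
      (trans (cong +_ (ℕₚ.*-comm (suc k) m)) (ℤₚ.pos-* m (suc k)))))
    (ℚᵘₚ.≃-sym (toℚᵘ-/ m 0))))

  lowerSum-≤ : ∀ m k → lowerSum m k ℚ.≤ fromℕ m
  lowerSum-≤ m k = ℚₚ.≤-trans
    (sum-≤ m k (suc k) _ λ i → /-anti m k (suc (toℕ i) ℕ.* m))
    (ℚₚ.≤-reflexive (cancel-/ m k))

-- The natural logarithm of n ≥ 1, as ∫ dx / x over [1 , n]: the supremum of
-- the lower sums (uniform partitions suffice).
log : (n : ℕ) .{{_ : NonZero n}} → ℝ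
log (suc m) = record
  { lower     = λ q → ∃[ k ] q ℚ.< lowerSum m k
  ; inhabited = let q , q< = below (lowerSum m 0) in q , 0 , q<
  ; bounded   = fromℕ m , λ (k , lt) → <⇒≱ lt (lowerSum-≤ m k)
  ; closed    = λ q<r (k , lt) → k , ℚₚ.<-trans q<r lt
  ; rounded   = λ (k , lt) → let r , q<r , r< = dense lt in r , q<r , k , r<
  }

threshold : ℝ → (p : ℕ) .{{_ : NonZero p}} → ℝ
threshold ε p = fromℚ (fromℕ p) ^ fromℚ ½ * log p ^ (fromℚ (fromℕ 2) + ε)

Products : (p : ℕ) .{{_ : NonZero p}} → ℝ → Fin p → Set
Products p B a = ∃[ x ] ∃[ y ]
  (1 ℕ.≤ x × fromℚ (fromℕ x) ≤ B ×
   1 ℕ.≤ y × fromℚ (fromℕ y) ≤ B ×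
   (x ℕ.* y) mod p ≡ a)

-- Bounds on the number of elements of a set S which need not be decidable
-- (x ≤ B is not decidable for a real number B).
infix 4 _≤#_ _#≤_

_≤#_ : ∀ {p} → ℚ → (Fin p → Set) → Set
c ≤# S = ∃[ as ] (Unique as × All S as × c ℚ.≤ fromℕ (length as))

_#≤_ : ∀ {p} → (Fin p → Set) → ℚ → Set
S #≤ c = ∀ as → Unique as → All S as → fromℕ (length as) ℚ.≤ c

{-# OPTIONS --safe #-}
-- Let s = ⌊√p⌋, let N ≥ s lie below the threshold, and let E be the number of solutions of
-- x y ≡ x′ y′ (mod p) in [1, N].  By Cauchy–Schwarz at least N⁴ / E classes are of the form x y, so
-- it suffices that E ≤ (1 + o(1)) N⁴ / p.
--
-- By Thue's lemma every pair (x, x′) satisfies u x ≡ ± w x′ with coprime 1 ≤ u, w ≤ s, and then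
-- x y ≡ x′ y′ means w y ≡ ± u y′.  With T = max(u, w), such a congruence has at most
-- N² / p + 7 N / T solutions in [1, N]², since for T consecutive values of one variable each line
-- u x ∓ w y = c + k p contains at most one of them.  Hence E ≤ N⁴ / p + 7 N Σ 1 / T over all (x, x′).
-- Grouping the pairs (x, x′) by (u, w, ±) and using the same bound again,
-- Σ 1 / T ≤ Σ_{u, w, ±} (N² / p + 7 N / T) / T = O(s N² / p + N log p).  Altogether
-- p E ≤ N⁴ + 28 N³ s + 196 N² p H with H = O(log p), and the choice N ≍ √p log p makes the error
-- terms smaller than the main term by a factor log p.
module Submission where

-- A uniform bound on the number of (y, y′) is impossible: for x = x′ there are at least N
-- solutions, far more than N² / p. Only the average over (x, x′) is small, which is why the
-- congruence bound is used twice, once for (y, y′) and once for the weights 1 / T. The larger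
-- coefficient serves as block length because the loss in the bound is inversely proportional to it.
-- Everything is counted in ℕ: 1 / T is replaced by D / T with D = s!, and logarithms by numbers of
-- dyadic blocks. Order on the cuts is not decidable, so integers below the threshold have to be
-- certified by explicit rational bases and exponents. This shapes N = h B, where h stays a constant
-- factor below √p and B is about the base-4 logarithm of p. Constant factors are harmless: they
-- only enlarge the constant K = `deficit` in p E ≤ N⁴ (1 + K / B).

module Counting where

  open import Data.Fin.Base using (Fin; toℕ; remQuot; combine)
  open import Data.Fin.Properties
    using (pigeonhole; combine-remQuot; toℕ-fromℕ<; toℕ<n; toℕ-injective)
    renaming (_≟_ to _≟ᶠ_)
  open import Data.List.Base
    using (List; []; _∷_; length; map; _++_; cartesianProduct; upTo; deduplicate)
  open import Data.List.Membership.Propositional using (_∈_)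
  open import Data.List.Membership.Propositional.Properties
    using (∈-upTo⁺; ∈-cartesianProduct⁻; ∈-map⁺; ∈-map⁻; ∈-deduplicate⁺; ∈-deduplicate⁻)
  open import Data.List.Properties using (length-upTo)
  open import Data.List.Relation.Unary.All using (lookup; tabulate)
  open import Data.List.Relation.Unary.AllPairs using ([]; _∷_)
  open import Data.List.Relation.Unary.Any using (here; there)
  open import Data.List.Relation.Unary.Unique.DecPropositional.Properties using (deduplicate-!)
  open import Data.List.Relation.Unary.Unique.Propositional using (Unique)
  open import Data.List.Relation.Unary.Unique.Propositional.Properties
    using (cartesianProduct⁺)
  open import Data.Nat.Base
  open import Data.Nat.Coprimality using (Coprime; coprime?; coprime-divisor; coprime-/gcd)
  open import Data.Nat.Divisibility
    using (_∣_; ∣m+n∣m⇒∣n; ∣⇒≤; m∣m*n; ∣-trans; m≤n⇒m!∣n!)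
  open import Data.Nat.DivMod
  open import Data.Nat.GCD using (gcd; gcd[m,n]∣m; gcd[m,n]∣n; gcd[m,n]≢0)
  open import Data.Nat.Primality using (Prime; euclidsLemma)
  open import Data.Nat.Properties
  open import Data.Nat.Tactic.RingSolver using (solve-∀)
  open import Data.Product.Base using (_×_; _,_; proj₁; proj₂; ∃-syntax; uncurry)
  open import Data.Sign.Base as Sign using (Sign)
  open import Data.Sum.Base using (_⊎_; inj₁; inj₂)
  open import Data.Unit.Base using (⊤; tt)
  open import Function.Base using (_∘_)
  open import Relation.Binary.Definitions using (DecidableEquality)
  open import Relation.Binary.PropositionalEquality
  open import Relation.Nullary using (Dec; yes; no; ¬_; contradiction; _×-dec_)

  -- Finite sums

  private variable
    A A′ : Set
    P Q : Set

  ∑ : List A → (A → ℕ) → ℕ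
  ∑ []       f = 0
  ∑ (x ∷ xs) f = f x + ∑ xs f

  𝟙 : Dec P → ℕ
  𝟙 (yes _) = 1
  𝟙 (no _)  = 0

  𝟙-≤ : (P? : Dec P) (n : ℕ) → (P → 1 ≤ n) → 𝟙 P? ≤ n
  𝟙-≤ (yes p) n f = f p
  𝟙-≤ (no _)  n f = z≤n

  𝟙-yes : (P? : Dec P) → P → 1 ≤ 𝟙 P?
  𝟙-yes (yes _) p = s≤s z≤n
  𝟙-yes (no ¬p) p = contradiction p ¬p

  𝟙-mono : (P? : Dec P) (Q? : Dec Q) → (P → Q) → 𝟙 P? ≤ 𝟙 Q?
  𝟙-mono P? Q? f = 𝟙-≤ P? (𝟙 Q?) (𝟙-yes Q? ∘ f)

  ∑-cong : (xs : List A) {f g : A → ℕ} → (∀ x → f x ≡ g x) → ∑ xs f ≡ ∑ xs g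
  ∑-cong []       f≗g = refl
  ∑-cong (x ∷ xs) f≗g = cong₂ _+_ (f≗g x) (∑-cong xs f≗g)

  ∑-mono : (xs : List A) {f g : A → ℕ} → (∀ {x} → x ∈ xs → f x ≤ g x) → ∑ xs f ≤ ∑ xs g
  ∑-mono []       f≤g = z≤n
  ∑-mono (x ∷ xs) f≤g = +-mono-≤ (f≤g (here refl)) (∑-mono xs (f≤g ∘ there))

  ∑-+ : (xs : List A) (f g : A → ℕ) → ∑ xs (λ x → f x + g x) ≡ ∑ xs f + ∑ xs g
  ∑-+ []       f g = refl
  ∑-+ (x ∷ xs) f g = trans (cong (f x + g x +_) (∑-+ xs f g))
    (interchange (f x) (g x) (∑ xs f) (∑ xs g))
    where
    interchange : ∀ a b c d → a + b + (c + d) ≡ a + c + (b + d)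
    interchange = solve-∀

  ∑-*ˡ : (xs : List A) (c : ℕ) (f : A → ℕ) → ∑ xs (λ x → c * f x) ≡ c * ∑ xs f
  ∑-*ˡ []       c f = sym (*-zeroʳ c)
  ∑-*ˡ (x ∷ xs) c f =
    trans (cong (c * f x +_) (∑-*ˡ xs c f)) (sym (*-distribˡ-+ c (f x) (∑ xs f)))

  ∑-*ʳ : (xs : List A) (c : ℕ) (f : A → ℕ) → ∑ xs (λ x → f x * c) ≡ ∑ xs f * c
  ∑-*ʳ xs c f = trans (∑-cong xs (λ x → *-comm (f x) c))
    (trans (∑-*ˡ xs c f) (*-comm c (∑ xs f)))

  ∑-const : (xs : List A) (c : ℕ) → ∑ xs (λ _ → c) ≡ length xs * c
  ∑-const []       c = refl
  ∑-const (x ∷ xs) c = cong (c +_) (∑-const xs c)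

  ∑-zero : (xs : List A) → ∑ xs (λ _ → 0) ≡ 0
  ∑-zero xs = trans (∑-const xs 0) (*-zeroʳ (length xs))

  ∑-swap : (xs : List A) (ys : List A′) (f : A → A′ → ℕ) →
           ∑ xs (λ x → ∑ ys (f x)) ≡ ∑ ys (λ y → ∑ xs (λ x → f x y))
  ∑-swap []       ys f = sym (∑-zero ys)
  ∑-swap (x ∷ xs) ys f = trans (cong (∑ ys (f x) +_) (∑-swap xs ys f))
    (sym (∑-+ ys (f x) (λ y → ∑ xs (λ x → f x y))))

  ∑-term : {xs : List A} (f : A → ℕ) {x : A} → x ∈ xs → f x ≤ ∑ xs f
  ∑-term f (here refl) = m≤m+n _ _
  ∑-term f (there x∈)  = ≤-trans (∑-term f x∈) (m≤n+m _ _)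

  ∑-++ : (xs ys : List A) (f : A → ℕ) → ∑ (xs ++ ys) f ≡ ∑ xs f + ∑ ys f
  ∑-++ []       ys f = refl
  ∑-++ (x ∷ xs) ys f = trans (cong (f x +_) (∑-++ xs ys f)) (sym (+-assoc (f x) _ _))

  ∑-map : (h : A → A′) (xs : List A) (f : A′ → ℕ) → ∑ (map h xs) f ≡ ∑ xs (f ∘ h)
  ∑-map h []       f = refl
  ∑-map h (x ∷ xs) f = cong (f (h x) +_) (∑-map h xs f)

  ∑-cartesianProduct : (xs : List A) (ys : List A′) (f : A × A′ → ℕ) →
    ∑ (cartesianProduct xs ys) f ≡ ∑ xs (λ x → ∑ ys (λ y → f (x , y)))
  ∑-cartesianProduct []       ys f = refl
  ∑-cartesianProduct (x ∷ xs) ys f =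
    trans (∑-++ (map (x ,_) ys) (cartesianProduct xs ys) f)
      (cong₂ _+_ (∑-map (x ,_) ys f) (∑-cartesianProduct xs ys f))

  ∑-none : {P : A → Set} (P? : ∀ x → Dec (P x)) (xs : List A) →
    (∀ {x} → x ∈ xs → ¬ P x) → ∑ xs (λ x → 𝟙 (P? x)) ≡ 0
  ∑-none P? []       none = refl
  ∑-none P? (x ∷ xs) none with P? x
  ... | yes p = contradiction p (none (here refl))
  ... | no  _ = ∑-none P? xs (none ∘ there)

  ∑-atMostOne : {P : A → Set} (P? : ∀ x → Dec (P x)) {xs : List A} → Unique xs →
    (∀ {x y} → x ∈ xs → y ∈ xs → P x → P y → x ≡ y) → ∑ xs (λ x → 𝟙 (P? x)) ≤ 1
  ∑-atMostOne P? []                  amo = z≤n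
  ∑-atMostOne P? {x ∷ xs} (x∉ ∷ u) amo with P? x
  ... | no  _ = ∑-atMostOne P? u (λ y∈ z∈ → amo (there y∈) (there z∈))
  ... | yes p = ≤-reflexive (cong suc (∑-none P? xs
    (λ y∈ q → lookup x∉ y∈ (amo (here refl) (there y∈) p q))))

  -- Each indicator is split according to the value of the code. After exchanging the sums, every
  -- code below K accounts for at most one element. Range and injectivity of the code are asked only
  -- where P holds.
  ∑-injection : {P : A → Set} (P? : ∀ x → Dec (P x)) {xs : List A} → Unique xs →
    (K : ℕ) (code : A → ℕ) → (∀ {x} → x ∈ xs → P x → code x < K) →
    (∀ {x y} → x ∈ xs → y ∈ xs → P x → P y → code x ≡ code y → x ≡ y) →
    ∑ xs (λ x → 𝟙 (P? x)) ≤ K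
  ∑-injection P? {xs} u K code code< inj = begin
    ∑ xs (λ x → 𝟙 (P? x))
      ≤⟨ ∑-mono xs (λ {x} x∈ → 𝟙-≤ (P? x) _ (λ p → ≤-trans
           (𝟙-yes (P? x ×-dec (code x ≟ code x)) (p , refl))
           (∑-term (λ c → 𝟙 (P? x ×-dec (code x ≟ c))) (∈-upTo⁺ (code< x∈ p))))) ⟩
    ∑ xs (λ x → ∑ (upTo K) (λ c → 𝟙 (P? x ×-dec (code x ≟ c))))
      ≡⟨ ∑-swap xs (upTo K) _ ⟩
    ∑ (upTo K) (λ c → ∑ xs (λ x → 𝟙 (P? x ×-dec (code x ≟ c))))
      ≤⟨ ∑-mono (upTo K) (λ {c} _ → ∑-atMostOne (λ x → P? x ×-dec (code x ≟ c)) u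
           (λ x∈ y∈ (p , e) (q , e′) → inj x∈ y∈ p q (trans e (sym e′)))) ⟩
    ∑ (upTo K) (λ _ → 1)
      ≡⟨ ∑-const (upTo K) 1 ⟩
    length (upTo K) * 1
      ≡⟨ *-identityʳ _ ⟩
    length (upTo K)
      ≡⟨ length-upTo K ⟩
    K ∎
    where open ≤-Reasoning

  -- Cauchy-Schwarz and coincidences of a map

  2ab≤a²+b² : ∀ a b → 2 * (a * b) ≤ a * a + b * b
  2ab≤a²+b² a b with ≤-total a b
  ... | inj₁ a≤b = subst (λ b → 2 * (a * b) ≤ a * a + b * b) (m+[n∸m]≡n a≤b)
    (≤-trans (m≤m+n _ _) (≤-reflexive (expand a (b ∸ a))))
    where
    expand : ∀ a d → 2 * (a * (a + d)) + d * d ≡ a * a + (a + d) * (a + d)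
    expand = solve-∀
  ... | inj₂ b≤a = subst (λ a → 2 * (a * b) ≤ a * a + b * b) (m+[n∸m]≡n b≤a)
    (≤-trans (m≤m+n _ _) (≤-reflexive (expand b (a ∸ b))))
    where
    expand : ∀ b d → 2 * ((b + d) * b) + d * d ≡ (b + d) * (b + d) + b * b
    expand = solve-∀

  cauchy-schwarz : (xs : List A) (f : A → ℕ) →
    ∑ xs f * ∑ xs f ≤ length xs * ∑ xs (λ x → f x * f x)
  cauchy-schwarz []       f = z≤n
  cauchy-schwarz (x ∷ xs) f = begin
    (a + S) * (a + S)                ≡⟨ expand a S ⟩
    a * a + 2 * (a * S) + S * S      ≤⟨ +-mono-≤ (+-monoʳ-≤ (a * a) cross) (cauchy-schwarz xs f) ⟩
    a * a + (n * (a * a) + T) + n * T  ≡⟨ collect (a * a) n T ⟩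
    suc n * (a * a + T)              ∎
    where
    open ≤-Reasoning
    a = f x
    S = ∑ xs f
    n = length xs
    T = ∑ xs (λ y → f y * f y)
    expand : ∀ a S → (a + S) * (a + S) ≡ a * a + 2 * (a * S) + S * S
    expand = solve-∀
    collect : ∀ b n T → b + (n * b + T) + n * T ≡ (1 + n) * (b + T)
    collect = solve-∀
    cross : 2 * (a * S) ≤ n * (a * a) + T
    cross = begin
      2 * (a * S)                          ≡⟨ cong (2 *_) (∑-*ˡ xs a f) ⟨
      2 * ∑ xs (λ y → a * f y)             ≡⟨ ∑-*ˡ xs 2 _ ⟨
      ∑ xs (λ y → 2 * (a * f y))           ≤⟨ ∑-mono xs (λ {y} _ → 2ab≤a²+b² a (f y)) ⟩
      ∑ xs (λ y → a * a + f y * f y)       ≡⟨ ∑-+ xs _ _ ⟩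
      ∑ xs (λ _ → a * a) + T               ≡⟨ cong (_+ T) (∑-const xs (a * a)) ⟩
      n * (a * a) + T                      ∎

  -- With `r b` the size of the fibre over b, the sum of `r` is at least the number of points, and
  -- the sum of its squares is at most the number of pairs with equal image. Cauchy-Schwarz compares
  -- the two.
  energy-bound : (_≟′_ : DecidableEquality A′) (zs : List A) (π : A → A′) {bs : List A′} →
    Unique bs → (∀ {z} → z ∈ zs → π z ∈ bs) →
    length zs * length zs ≤ length bs * ∑ zs (λ z → ∑ zs (λ z′ → 𝟙 (π z ≟′ π z′)))
  energy-bound {A′ = A′} {A = A} _≟′_ zs π {bs} u π∈ = begin
    length zs * length zs                ≤⟨ *-mono-≤ total total ⟩
    ∑ bs r * ∑ bs r                      ≤⟨ cauchy-schwarz bs r ⟩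
    length bs * ∑ bs (λ b → r b * r b)   ≤⟨ *-monoʳ-≤ (length bs) squares ⟩
    length bs * ∑ zs (λ z → ∑ zs (λ z′ → 𝟙 (π z ≟′ π z′))) ∎
    where
    open ≤-Reasoning
    χ : A → A′ → ℕ
    χ z b = 𝟙 (π z ≟′ b)
    r : A′ → ℕ
    r b = ∑ zs (λ z → χ z b)
    total : length zs ≤ ∑ bs r
    total = begin
      length zs                          ≡⟨ *-identityʳ _ ⟨
      length zs * 1                      ≡⟨ ∑-const zs 1 ⟨
      ∑ zs (λ _ → 1)                     ≤⟨ ∑-mono zs (λ {z} z∈ →
                                            ≤-trans (𝟙-yes (π z ≟′ π z) refl) (∑-term (χ z) (π∈ z∈))) ⟩
      ∑ zs (λ z → ∑ bs (χ z))            ≡⟨ ∑-swap zs bs χ ⟩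
      ∑ bs r                             ∎
    pair : ∀ z z′ → ∑ bs (λ b → χ z b * χ z′ b) ≤ 𝟙 (π z ≟′ π z′)
    pair z z′ with π z ≟′ π z′
    ... | yes e = ≤-trans
      (∑-mono bs (λ {b} _ → ≤-trans (*-monoʳ-≤ (χ z b) (𝟙-≤ (π z′ ≟′ b) 1 (λ _ → ≤-refl)))
        (≤-reflexive (*-identityʳ _))))
                    (∑-atMostOne (π z ≟′_) u (λ _ _ p q → trans (sym p) q))
    ... | no ¬e = ≤-trans (∑-mono bs (λ {b} _ → disjoint b)) (≤-reflexive (∑-zero bs))
      where
      disjoint : ∀ b → χ z b * χ z′ b ≤ 0
      disjoint b with π z ≟′ b | π z′ ≟′ b
      ... | yes p | yes q = contradiction (trans p (sym q)) ¬e
      ... | yes p | no  _ = z≤n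
      ... | no  _ | _     = z≤n
    squares : ∑ bs (λ b → r b * r b) ≤ ∑ zs (λ z → ∑ zs (λ z′ → 𝟙 (π z ≟′ π z′)))
    squares = begin
      ∑ bs (λ b → r b * r b)
        ≡⟨ ∑-cong bs (λ b → trans (sym (∑-*ʳ zs (r b) _)) (∑-cong zs (λ z → sym (∑-*ˡ zs (χ z b) _)))) ⟩
      ∑ bs (λ b → ∑ zs (λ z → ∑ zs (λ z′ → χ z b * χ z′ b)))
        ≡⟨ ∑-swap bs zs _ ⟩
      ∑ zs (λ z → ∑ bs (λ b → ∑ zs (λ z′ → χ z b * χ z′ b)))
        ≡⟨ ∑-cong zs (λ z → ∑-swap bs zs _) ⟩
      ∑ zs (λ z → ∑ zs (λ z′ → ∑ bs (λ b → χ z b * χ z′ b)))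
        ≤⟨ ∑-mono zs (λ {z} _ → ∑-mono zs (λ {z′} _ → pair z z′)) ⟩
      ∑ zs (λ z → ∑ zs (λ z′ → 𝟙 (π z ≟′ π z′))) ∎

  -- Intervals and squares of integers

  interval : ℕ → ℕ → List ℕ
  interval a zero    = []
  interval a (suc n) = a ∷ interval (suc a) n

  ∈-interval⁻ : ∀ {x} a n → x ∈ interval a n → a ≤ x × x < a + n
  ∈-interval⁻ a (suc n) (here refl) = ≤-refl , m<m+n a (s≤s z≤n)
  ∈-interval⁻ a (suc n) (there x∈)  with ∈-interval⁻ (suc a) n x∈
  ... | a<x , x< = <⇒≤ a<x , <-≤-trans x< (≤-reflexive (sym (+-suc a n)))

  ∈-interval⁺ : ∀ {x} a n → a ≤ x → x < a + n → x ∈ interval a n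
  ∈-interval⁺ a zero    a≤x x<a = contradiction (<-≤-trans x<a (≤-reflexive (+-identityʳ a))) (≤⇒≯ a≤x)
  ∈-interval⁺ a (suc n) a≤x x<a+n with m≤n⇒m<n∨m≡n a≤x
  ... | inj₂ refl = here refl
  ... | inj₁ a<x  = there (∈-interval⁺ (suc a) n a<x (<-≤-trans x<a+n (≤-reflexive (+-suc a n))))

  interval-unique : ∀ a n → Unique (interval a n)
  interval-unique a zero    = []
  interval-unique a (suc n) =
    tabulate (λ x∈ → <⇒≢ (proj₁ (∈-interval⁻ (suc a) n x∈))) ∷ interval-unique (suc a) n

  length-interval : ∀ a n → length (interval a n) ≡ n
  length-interval a zero    = refl
  length-interval a (suc n) = cong suc (length-interval (suc a) n)

  square : ℕ → List (ℕ × ℕ)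
  square N = cartesianProduct (interval 1 N) (interval 1 N)

  square-unique : ∀ N → Unique (square N)
  square-unique N = cartesianProduct⁺ (interval-unique 1 N) (interval-unique 1 N)

  ∈-interval-1⁻ : ∀ {x N} → x ∈ interval 1 N → 1 ≤ x × x ≤ N
  ∈-interval-1⁻ {N = N} x∈ with ∈-interval⁻ 1 N x∈
  ... | 1≤x , x<1+N = 1≤x , s≤s⁻¹ x<1+N

  ∈-square⁻ : ∀ {x y N} → (x , y) ∈ square N → (1 ≤ x × x ≤ N) × (1 ≤ y × y ≤ N)
  ∈-square⁻ {N = N} z∈ with ∈-cartesianProduct⁻ (interval 1 N) (interval 1 N) z∈
  ... | x∈ , y∈ = ∈-interval-1⁻ x∈ , ∈-interval-1⁻ y∈

  length-square : ∀ N → length (square N) ≡ N * N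
  length-square N = trans (sym (*-identityʳ _)) (trans (sym (∑-const (square N) 1))
    (trans (∑-cartesianProduct I I _) (trans (∑-cong I λ _ → ∑-const I 1)
    (trans (∑-const I _) (cong₂ _*_ |I| (trans (*-identityʳ _) |I|))))))
    where
    I = interval 1 N
    |I| = length-interval 1 N

  -- Harmonic sums

  ∑-interval-+ : ∀ a m n (f : ℕ → ℕ) →
    ∑ (interval a (m + n)) f ≡ ∑ (interval a m) f + ∑ (interval (a + m) n) f
  ∑-interval-+ a zero    n f = cong (λ b → ∑ (interval b n) f) (sym (+-identityʳ a))
  ∑-interval-+ a (suc m) n f = trans (cong (f a +_) (trans (∑-interval-+ (suc a) m n f)
      (cong (λ b → ∑ (interval (suc a) m) f + ∑ (interval b n) f) (sym (+-suc a m)))))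
    (sym (+-assoc (f a) _ _))

  ∑-interval-mono : ∀ a {m n} (f : ℕ → ℕ) → m ≤ n → ∑ (interval a m) f ≤ ∑ (interval a n) f
  ∑-interval-mono a {m} {n} f m≤n = subst (λ k → ∑ (interval a m) f ≤ ∑ (interval a k) f) (m+[n∸m]≡n m≤n)
    (≤-trans (m≤m+n _ _) (≤-reflexive (sym (∑-interval-+ a m (n ∸ m) f))))

  ∑-interval-const : ∀ a n c → ∑ (interval a n) (λ _ → c) ≡ n * c
  ∑-interval-const a n c = trans (∑-const (interval a n) c) (cong (_* c) (length-interval a n))

  -- This is 2^e - 1, built by appending dyadic blocks so that harmonic sums split along the
  -- recursion.
  mersenne : ℕ → ℕ
  mersenne zero    = 0
  mersenne (suc e) = mersenne e + 2 ^ e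

  1+mersenne : ∀ e → suc (mersenne e) ≡ 2 ^ e
  1+mersenne zero    = refl
  1+mersenne (suc e) = trans (cong (_+ 2 ^ e) (1+mersenne e)) (cong (2 ^ e +_) (sym (+-identityʳ (2 ^ e))))

  module _ {D : ℕ} (g : ℕ → ℕ) where

    -- The block [2^e, 2^(e+1)) has 2^e terms, each at most D / 2^e, so it contributes at most D.
    harmonic-upper : (∀ {t} → 1 ≤ t → t * g t ≤ D) → ∀ e → ∑ (interval 1 (mersenne e)) g ≤ e * D
    harmonic-upper t*gt≤D zero    = z≤n
    harmonic-upper t*gt≤D (suc e) = begin
      ∑ (interval 1 (mersenne e + 2 ^ e)) g
        ≡⟨ ∑-interval-+ 1 (mersenne e) (2 ^ e) g ⟩
      ∑ (interval 1 (mersenne e)) g + ∑ (interval (suc (mersenne e)) (2 ^ e)) g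
        ≤⟨ +-mono-≤ (harmonic-upper t*gt≤D e) block ⟩
      e * D + D
        ≡⟨ +-comm (e * D) D ⟩
      suc e * D ∎
      where
      open ≤-Reasoning
      I = interval (suc (mersenne e)) (2 ^ e)
      instance
        2^e≢0 : NonZero (2 ^ e)
        2^e≢0 = m^n≢0 2 e
      block : ∑ I g ≤ D
      block = *-cancelˡ-≤ (2 ^ e) (begin
        2 ^ e * ∑ I g              ≡⟨ ∑-*ˡ I (2 ^ e) g ⟨
        ∑ I (λ t → 2 ^ e * g t)    ≤⟨ ∑-mono I (λ {t} t∈ → let lo = proj₁ (∈-interval⁻ _ (2 ^ e) t∈) in
                                       ≤-trans (*-monoˡ-≤ (g t) (≤-trans (≤-reflexive (sym (1+mersenne e))) lo))
                                         (t*gt≤D (≤-trans (s≤s z≤n) lo))) ⟩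
        ∑ I (λ _ → D)              ≡⟨ ∑-interval-const _ (2 ^ e) D ⟩
        2 ^ e * D                  ∎)

    -- The blocks are now (2^e, 2^(e+1)], whose 2^e terms are each at least D / 2^(e+1), giving D /
    -- 2 per block. The sum starts at 2 to match the lower Riemann sum of the logarithm with unit
    -- steps.
    harmonic-lower : ∀ e → (∀ {t} → 1 ≤ t → t ≤ 2 ^ e → D ≤ t * g t) →
      e * D ≤ 2 * ∑ (interval 2 (mersenne e)) g
    harmonic-lower zero    D≤ = z≤n
    harmonic-lower (suc e) D≤ = begin
      suc e * D
        ≡⟨ +-comm D (e * D) ⟩
      e * D + D
        ≤⟨ +-mono-≤ (harmonic-lower e (λ 1≤t t≤ → D≤ 1≤t (≤-trans t≤ (m≤m+n (2 ^ e) _)))) block ⟩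
      2 * ∑ (interval 2 (mersenne e)) g + 2 * ∑ I g
        ≡⟨ *-distribˡ-+ 2 (∑ (interval 2 (mersenne e)) g) (∑ I g) ⟨
      2 * (∑ (interval 2 (mersenne e)) g + ∑ I g)
        ≡⟨ cong (2 *_) (∑-interval-+ 2 (mersenne e) (2 ^ e) g) ⟨
      2 * ∑ (interval 2 (mersenne e + 2 ^ e)) g ∎
      where
      open ≤-Reasoning
      I = interval (2 + mersenne e) (2 ^ e)
      instance
        2^e≢0 : NonZero (2 ^ e)
        2^e≢0 = m^n≢0 2 e
      ≤2^1+e : ∀ {t} → t < 2 + mersenne e + 2 ^ e → t ≤ 2 * 2 ^ e
      ≤2^1+e t< = ≤-trans (s≤s⁻¹ t<) (≤-reflexive
        (trans (cong (_+ 2 ^ e) (1+mersenne e)) (cong (2 ^ e +_) (sym (+-identityʳ (2 ^ e))))))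
      block : D ≤ 2 * ∑ I g
      block = *-cancelˡ-≤ (2 ^ e) (begin
        2 ^ e * D                        ≡⟨ ∑-interval-const _ (2 ^ e) D ⟨
        ∑ I (λ _ → D)                    ≤⟨ ∑-mono I (λ {t} t∈ → let lo , hi = ∈-interval⁻ _ (2 ^ e) t∈ in
                                             ≤-trans (D≤ (≤-trans (s≤s z≤n) lo) (≤2^1+e hi))
                                               (*-monoˡ-≤ (g t) (≤2^1+e hi))) ⟩
        ∑ I (λ t → 2 * 2 ^ e * g t)      ≡⟨ ∑-*ˡ I (2 * 2 ^ e) g ⟩
        2 * 2 ^ e * ∑ I g                ≡⟨ reorder (2 ^ e) (∑ I g) ⟩
        2 ^ e * (2 * ∑ I g)              ∎)
        where
        reorder : ∀ a b → 2 * a * b ≡ a * (2 * b)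
        reorder = solve-∀

  -- with the junk value 0 at t = 0
  factorialOver : ℕ → ℕ → ℕ
  factorialOver n zero      = 0
  factorialOver n t@(suc _) = n ! / t

  t*factorialOver≡ : ∀ {n t} → 1 ≤ t → t ≤ n → t * factorialOver n t ≡ n !
  t*factorialOver≡ {n} {suc t} _ t<n =
    m*[n/m]≡n (∣-trans (m∣m*n (t !)) (m≤n⇒m!∣n! t<n))

  t*factorialOver≤ : ∀ {n t} → 1 ≤ t → t * factorialOver n t ≤ n !
  t*factorialOver≤ {n} {suc t} _ =
    ≤-trans (≤-reflexive (*-comm (suc t) (n ! / suc t))) (m/n*n≤m (n !) (suc t))

  ^-distribʳ-* : ∀ n a b → (a * b) ^ n ≡ a ^ n * b ^ n
  ^-distribʳ-* zero    a b = refl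
  ^-distribʳ-* (suc n) a b = trans (cong (a * b *_) (^-distribʳ-* n a b))
    (interchange a b (a ^ n) (b ^ n))
    where
    interchange : ∀ a b c d → a * b * (c * d) ≡ a * c * (b * d)
    interchange = solve-∀

  -- An integer form of c ≤ b^(k / (2k + 1)). The odd factor c is absorbed by 2^k, which the factor
  -- 2 in 2 c² ≤ b pays for.
  power-bound : ∀ {c b} k → c ≤ 2 ^ k → 2 * (c * c) ≤ b →
    c ^ suc (2 * k) ≤ b ^ k
  power-bound {c} {b} k c≤2^k 2cc≤b = begin
    c * c ^ (2 * k)        ≡⟨ cong (c *_) (^-*-assoc c 2 k) ⟨
    c * (c ^ 2) ^ k        ≤⟨ *-monoˡ-≤ ((c ^ 2) ^ k) c≤2^k ⟩
    2 ^ k * (c ^ 2) ^ k  ≡⟨ ^-distribʳ-* k 2 (c ^ 2) ⟨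
    (2 * c ^ 2) ^ k        ≤⟨ ^-monoˡ-≤ k (subst (λ d → 2 * (c * d) ≤ b) (sym (*-identityʳ c)) 2cc≤b) ⟩
    b ^ k                      ∎
    where open ≤-Reasoning

  n<2^n : ∀ n → n < 2 ^ n
  n<2^n zero    = s≤s z≤n
  n<2^n (suc n) = ≤-trans (+-mono-≤ (m^n>0 2 n) (n<2^n n))
    (≤-reflexive (cong (2 ^ n +_) (sym (+-identityʳ (2 ^ n)))))

  -- Solutions of a linear congruence in a square

  digits-injective : ∀ {K q q′ r r′} .{{_ : NonZero K}} → r < K → r′ < K →
    q * K + r ≡ q′ * K + r′ → q ≡ q′ × r ≡ r′
  digits-injective {K} {q} {q′} {r} {r′} r<K r′<K eq = q≡q′ , r≡r′
    where
    last : ∀ q {r} → r < K → (q * K + r) % K ≡ r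
    last q {r} r<K = trans (cong (_% K) (+-comm (q * K) r))
      (trans ([m+kn]%n≡m%n r q K) (m<n⇒m%n≡m r<K))
    r≡r′ : r ≡ r′
    r≡r′ = trans (sym (last q r<K)) (trans (cong (_% K) eq) (last q′ r′<K))
    q≡q′ : q ≡ q′
    q≡q′ = *-cancelʳ-≡ q q′ K (+-cancelʳ-≡ r (q * K) (q′ * K)
      (trans eq (cong (q′ * K +_) (sym r≡r′))))

  m<[1+m/n]*n : ∀ m n .{{_ : NonZero n}} → m < suc (m / n) * n
  m<[1+m/n]*n m n = subst (_< suc (m / n) * n) (sym (m≡m%n+[m/n]*n m n))
    (+-monoˡ-< (m / n * n) (m%n<n m n))

  /-subadditive : ∀ m n p .{{_ : NonZero p}} → (m + n) / p ≤ m / p + (n / p + 1)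
  /-subadditive m n p = m<1+n⇒m≤n (m<n*o⇒m/o<n (<-≤-trans
    (+-mono-< (m<[1+m/n]*n m p) (m<[1+m/n]*n n p))
    (≤-reflexive (collect (m / p) (n / p) p))))
    where
    collect : ∀ a b p → suc a * p + suc b * p ≡ suc (a + (b + 1)) * p
    collect = solve-∀

  %-/-injective : ∀ {m n} p .{{_ : NonZero p}} → m % p ≡ n % p → m / p ≡ n / p → m ≡ n
  %-/-injective {m} {n} p eq% eq/ = trans (m≡m%n+[m/n]*n m p)
    (trans (cong₂ (λ r q → r + q * p) eq% eq/) (sym (m≡m%n+[m/n]*n n p)))

  -- Modulo w the equation says that w divides u (i′ - i), hence i′ - i by coprimality, and this
  -- difference is smaller than w.
  linear-injective : ∀ {u w i i′ b b′} → Coprime u w → i < w → i′ < w →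
    u * i + w * b ≡ u * i′ + w * b′ → i ≡ i′
  linear-injective {u} {w} cop i<w i′<w eq = case-≤ (≤-total _ _)
    where
    ordered : ∀ {i i′ b b′} → i ≤ i′ → i′ < w → u * i + w * b ≡ u * i′ + w * b′ → i ≡ i′
    ordered {i} {i′} {b} {b′} i≤i′ i′<w eq = go (i′ ∸ i) refl
      where
      d = i′ ∸ i
      expand : ∀ u i d c → u * (i + d) + c ≡ u * i + (c + u * d)
      expand = solve-∀
      split : u * i + w * b ≡ u * i + (w * b′ + u * d)
      split = trans eq (trans (cong (λ j → u * j + w * b′) (sym (m+[n∸m]≡n i≤i′)))
        (expand u i d (w * b′)))
      w∣ud : w ∣ u * d
      w∣ud = ∣m+n∣m⇒∣n (subst (w ∣_) (+-cancelˡ-≡ (u * i) _ _ split) (m∣m*n b)) (m∣m*n b′)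
      w∣d : w ∣ d
      w∣d = coprime-divisor (λ (x , y) → cop (y , x)) w∣ud
      go : ∀ e → d ≡ e → i ≡ i′
      go zero    d≡0 = ≤-antisym i≤i′ (m∸n≡0⇒m≤n d≡0)
      go (suc e) d≡e = contradiction (∣⇒≤ (subst (w ∣_) d≡e w∣d))
        (<⇒≱ (≤-<-trans (≤-trans (≤-reflexive (sym d≡e)) (m∸n≤m i′ i)) i′<w))
    case-≤ : _ ≤ _ ⊎ _ ≤ _ → _
    case-≤ (inj₁ i≤i′) = ordered i≤i′ i′<w eq
    case-≤ (inj₂ i′≤i) = sym (ordered i′≤i i<w (sym eq))

  -- Each block of w consecutive values of a meets every line u a + w b = c + k p
  -- at most once, and meets at most w (u + N) / p + 2 of these lines.
  count-residue : ∀ {p u w N c} .{{_ : NonZero p}} .{{_ : NonZero w}}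
    {P : A → Set} (P? : ∀ z → Dec (P z)) {zs : List A} → Unique zs →
    (a b : A → ℕ) → (∀ {z} → z ∈ zs → a z ≤ N) → (∀ {z} → z ∈ zs → b z ≤ N) →
    (∀ {z z′} → z ∈ zs → z′ ∈ zs → a z ≡ a z′ → b z ≡ b z′ → z ≡ z′) →
    (∀ {z} → P z → Coprime u w) →
    (∀ {z} → z ∈ zs → P z → (u * a z + w * b z) % p ≡ c) →
    ∑ zs (λ z → 𝟙 (P? z)) ≤ (N / w + 1) * (w * (u + N) / p + 2)
  count-residue {A = A} {p = p} {u} {w} {N} {c} {P} P? {zs} uniq a b a≤ b≤ ab-inj cop res =
    ∑-injection P? uniq ((N / w + 1) * K) code code< code-inj
    where
    K = w * (u + N) / p + 2
    instance
      K≢0 : NonZero K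
      K≢0 = >-nonZero (≤-trans (s≤s z≤n) (m≤n+m 2 (w * (u + N) / p)))
    value base offset code : A → ℕ
    value z  = u * a z + w * b z
    base z   = u * (a z / w * w)
    -- Lines are numbered by the quotient of the value by p, counted from that of the block's base.
    -- Beyond its base a block reaches at most w (u + N); adding quotients costs 1, and the strict
    -- bound by K another 1.
    offset z = value z / p ∸ base z / p
    code z   = a z / w * K + offset z

    a-digits : ∀ z → a z ≡ a z % w + a z / w * w
    a-digits z = m≡m%n+[m/n]*n (a z) w

    value-split : ∀ z → value z ≡ base z + (u * (a z % w) + w * b z)
    value-split z = trans (cong (λ a → u * a + w * b z) (a-digits z))
      (expand u (a z % w) (a z / w * w) (w * b z))
      where
      expand : ∀ u i q c → u * (i + q) + c ≡ u * q + (u * i + c)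
      expand = solve-∀

    base≤value : ∀ z → base z / p ≤ value z / p
    base≤value z = /-monoˡ-≤ p (≤-trans (m≤m+n _ _) (≤-reflexive (sym (value-split z))))

    offset<K : ∀ {z} → z ∈ zs → offset z < K
    offset<K {z} z∈ = ≤-<-trans (m≤n+o⇒m∸n≤o (value z / p) (base z / p) (begin
      value z / p                          ≡⟨ cong (_/ p) (value-split z) ⟩
      (base z + Z) / p                     ≤⟨ /-subadditive (base z) Z p ⟩
      base z / p + (Z / p + 1)             ≤⟨ +-monoʳ-≤ (base z / p) (+-monoˡ-≤ 1 (/-monoˡ-≤ p Z≤)) ⟩
      base z / p + (w * (u + N) / p + 1)   ∎)) (+-monoʳ-< _ (s≤s (s≤s z≤n)))
      where
      open ≤-Reasoning
      Z = u * (a z % w) + w * b z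
      Z≤ : Z ≤ w * (u + N)
      Z≤ = ≤-trans (+-mono-≤ (*-monoʳ-≤ u (m%n≤n (a z) w)) (*-monoʳ-≤ w (b≤ z∈)))
        (≤-reflexive (trans (cong (_+ w * N) (*-comm u w)) (sym (*-distribˡ-+ w u N))))

    code< : ∀ {z} → z ∈ zs → P z → code z < (N / w + 1) * K
    code< {z} z∈ _ = begin-strict
      a z / w * K + offset z  <⟨ +-monoʳ-< (a z / w * K) (offset<K z∈) ⟩
      a z / w * K + K         ≤⟨ +-monoˡ-≤ K (*-monoˡ-≤ K (/-monoˡ-≤ w (a≤ z∈))) ⟩
      N / w * K + K           ≡⟨ collect (N / w) K ⟩
      (N / w + 1) * K         ∎
      where
      open ≤-Reasoning
      collect : ∀ n K → n * K + K ≡ (n + 1) * K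
      collect = solve-∀

    code-inj : ∀ {z z′} → z ∈ zs → z′ ∈ zs → P z → P z′ → code z ≡ code z′ → z ≡ z′
    code-inj {z} {z′} z∈ z′∈ Pz Pz′ eq = ab-inj z∈ z′∈ a≡a′ b≡b′
      where
      -- Equal codes give the same block, so the same base and then the same quotient. With the
      -- common residue the values agree, and `linear-injective` separates the positions inside the
      -- block.
      digits = digits-injective (offset<K z∈) (offset<K z′∈) eq
      block≡ : a z / w ≡ a z′ / w
      block≡ = proj₁ digits
      base≡ : base z ≡ base z′
      base≡ = cong (λ q → u * (q * w)) block≡
      quotient≡ : value z / p ≡ value z′ / p
      quotient≡ = ∸-cancelʳ-≡ (base≤value z)
        (subst (λ v → v / p ≤ value z′ / p) (sym base≡) (base≤value z′))
        (trans (proj₂ digits) (cong (λ v → value z′ / p ∸ v / p) (sym base≡)))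
      value≡ : value z ≡ value z′
      value≡ = %-/-injective p (trans (res z∈ Pz) (sym (res z′∈ Pz′))) quotient≡
      remainder≡ : a z % w ≡ a z′ % w
      remainder≡ = linear-injective (cop Pz) (m%n<n (a z) w) (m%n<n (a z′) w)
        (+-cancelˡ-≡ (base z) _ _ (trans (sym (value-split z)) (trans value≡
          (trans (value-split z′) (cong (_+ (u * (a z′ % w) + w * b z′)) (sym base≡))))))
      a≡a′ : a z ≡ a z′
      a≡a′ = %-/-injective w remainder≡ block≡
      b≡b′ : b z ≡ b z′
      b≡b′ = *-cancelˡ-≡ (b z) (b z′) w (+-cancelˡ-≡ (u * a z) _ _
        (trans value≡ (cong (λ v → u * v + w * b z′) (sym a≡a′))))

  -- Clearing the divisions gives (N + w) (w (u + N) + 2 p). Apart from N² w, its five terms are at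
  -- most 1, 2, 1, 1 and 2 times N p, which is the origin of the 7.
  block-bound : ∀ {p u w N J} .{{_ : NonZero p}} .{{_ : NonZero w}} →
    w * u ≤ p → w * w ≤ p → w ≤ N → J ≤ (N / w + 1) * (w * (u + N) / p + 2) →
    p * w * J ≤ N * N * w + 7 * N * p
  block-bound {p} {u} {w} {N} {J} wu≤p ww≤p w≤N J≤ = begin
    p * w * J                                           ≤⟨ *-monoʳ-≤ (p * w) J≤ ⟩
    p * w * ((N / w + 1) * (Z / p + 2))                 ≡⟨ regroup p w (N / w) (Z / p) ⟩
    (N / w * w + w) * (Z / p * p + 2 * p)               ≤⟨ *-mono-≤ (+-monoˡ-≤ w (m/n*n≤m N w))
                                                             (+-monoˡ-≤ (2 * p) (m/n*n≤m Z p)) ⟩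
    (N + w) * (w * (u + N) + 2 * p)                     ≡⟨ expand N w u p ⟩
    N * N * w + (N * (w * u) + 2 * N * p + w * (w * u) + N * (w * w) + 2 * w * p)
      ≤⟨ +-monoʳ-≤ (N * N * w) (+-mono-≤ (+-mono-≤ (+-mono-≤ (+-monoˡ-≤ (2 * N * p)
           (*-monoʳ-≤ N wu≤p)) (*-mono-≤ w≤N wu≤p)) (*-monoʳ-≤ N ww≤p))
           (*-monoˡ-≤ p (*-monoʳ-≤ 2 w≤N))) ⟩
    N * N * w + (N * p + 2 * N * p + N * p + N * p + 2 * N * p)  ≡⟨ collect (N * N * w) N p ⟩
    N * N * w + 7 * N * p                               ∎
    where
    open ≤-Reasoning
    Z = w * (u + N)
    regroup : ∀ p w a b → p * w * ((a + 1) * (b + 2)) ≡ (a * w + w) * (b * p + 2 * p)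
    regroup = solve-∀
    expand : ∀ N w u p → (N + w) * (w * (u + N) + 2 * p) ≡
      N * N * w + (N * (w * u) + 2 * N * p + w * (w * u) + N * (w * w) + 2 * w * p)
    expand = solve-∀
    collect : ∀ c N p → c + (N * p + 2 * N * p + N * p + N * p + 2 * N * p) ≡ c + 7 * N * p
    collect = solve-∀

  -- Linear congruences as divisibility in ℤ

  module Congruence where

    open import Data.Integer.Base using (ℤ; +_; -[1+_]; ∣_∣)
      renaming (_+_ to _+ᶻ_; _*_ to _*ᶻ_; _-_ to _-ᶻ_; -_ to -ᶻ_)
    open import Data.Integer.Divisibility.Signed using (divides; ∣⇒∣ᵤ; ∣ᵤ⇒∣)
      renaming (_∣_ to _∣ᶻ_; _∣?_ to _∣ᶻ?_)
    import Data.Integer.Properties as ℤₚ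
    import Data.Integer.Tactic.RingSolver as ℤ-Ring

    pos-linear : ∀ u x w y → + (u * x + w * y) ≡ + u *ᶻ + x +ᶻ + w *ᶻ + y
    pos-linear u x w y = trans (ℤₚ.pos-+ (u * x) (w * y)) (cong₂ _+ᶻ_ (ℤₚ.pos-* u x) (ℤₚ.pos-* w y))

    pos-∸ : ∀ {m n} → n ≤ m → + (m ∸ n) ≡ + m -ᶻ + n
    pos-∸ {m} {n} n≤m = sym (trans (ℤₚ.m-n≡m⊖n m n) (ℤₚ.⊖-≥ n≤m))

    ∣-difference⇒% : ∀ {p a b} .{{_ : NonZero p}} → + p ∣ᶻ + a -ᶻ + b → a % p ≡ b % p
    ∣-difference⇒% {p} {a} {b} (divides (+ k) eq) =
      trans (cong (_% p) a≡) ([m+kn]%n≡m%n b k p)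
      where
      shift : ∀ a b → a ≡ b +ᶻ (a -ᶻ b)
      shift = ℤ-Ring.solve-∀
      a≡ : a ≡ b + k * p
      a≡ = ℤₚ.+-injective (trans (shift (+ a) (+ b)) (trans (cong (+ b +ᶻ_)
        (trans eq (sym (ℤₚ.pos-* k p)))) (sym (ℤₚ.pos-+ b (k * p)))))
    ∣-difference⇒% {p} {a} {b} (divides -[1+ k ] eq) =
      sym (trans (cong (_% p) b≡) ([m+kn]%n≡m%n a (suc k) p))
      where
      shift : ∀ a b → b ≡ a +ᶻ -ᶻ (a -ᶻ b)
      shift = ℤ-Ring.solve-∀
      b≡ : b ≡ a + suc k * p
      b≡ = ℤₚ.+-injective (trans (shift (+ a) (+ b)) (trans (cong (+ a +ᶻ_)
        (trans (cong -ᶻ_ eq) (trans (ℤₚ.neg-distribˡ-* -[1+ k ] (+ p)) (sym (ℤₚ.pos-* (suc k) p)))))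
        (sym (ℤₚ.pos-+ a (suc k * p)))))

    %⇒∣-difference : ∀ {p a b} .{{_ : NonZero p}} → a % p ≡ b % p → + p ∣ᶻ + a -ᶻ + b
    %⇒∣-difference {p} {a} {b} eq = divides (+ (a / p) -ᶻ + (b / p))
      (trans (cong₂ _-ᶻ_ (digits a) (digits b))
      (trans (cong (λ r → + r +ᶻ + (a / p) *ᶻ + p -ᶻ (+ (b % p) +ᶻ + (b / p) *ᶻ + p)) eq)
      (cancel (+ (b % p)) (+ (a / p)) (+ (b / p)) (+ p))))
      where
      digits : ∀ a → + a ≡ + (a % p) +ᶻ + (a / p) *ᶻ + p
      digits a = trans (cong +_ (m≡m%n+[m/n]*n a p)) (trans (ℤₚ.pos-+ (a % p) (a / p * p))
        (cong (+ (a % p) +ᶻ_) (ℤₚ.pos-* (a / p) p)))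
      cancel : ∀ r k l p → r +ᶻ k *ᶻ p -ᶻ (r +ᶻ l *ᶻ p) ≡ (k -ᶻ l) *ᶻ p
      cancel = ℤ-Ring.solve-∀

    prime-cancel : ∀ {p k i} → Prime p → 1 ≤ k → k < p → + p ∣ᶻ + k *ᶻ i → + p ∣ᶻ i
    prime-cancel {p} {k} {i} pr 1≤k k<p p∣ki
      with euclidsLemma k ∣ i ∣ pr (subst (p ∣_) (ℤₚ.abs-* (+ k) i) (∣⇒∣ᵤ p∣ki))
    ... | inj₁ p∣k = contradiction (∣⇒≤ {{>-nonZero 1≤k}} p∣k) (<⇒≱ k<p)
    ... | inj₂ p∣i = ∣ᵤ⇒∣ p∣i

    signed : Sign → ℕ → ℤ
    signed Sign.+ w = + w
    signed Sign.- w = -ᶻ + w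

    signed-* : ∀ σ m n → signed σ (m * n) ≡ + m *ᶻ signed σ n
    signed-* Sign.+ m n = ℤₚ.pos-* m n
    signed-* Sign.- m n = trans (cong -ᶻ_ (ℤₚ.pos-* m n)) (ℤₚ.neg-distribʳ-* (+ m) (+ n))

    -- Cleared of denominators, this says that x / y is the signed fraction w / u modulo p. The sign
    -- is kept apart so that u and w remain natural numbers.
    Ratio : ℕ → ℕ → Sign → ℕ → ℕ × ℕ → Set
    Ratio p u σ w (x , y) = + p ∣ᶻ + u *ᶻ + x -ᶻ signed σ w *ᶻ + y

    -- Coprimality belongs to the predicate, so that `ratioCount` is bounded for every u and w,
    -- being zero when they share a factor, and sums can run over all of [1, s]².
    ReducedRatio : ℕ → ℕ → Sign → ℕ → ℕ × ℕ → Set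
    ReducedRatio p u σ w z = Coprime u w × Ratio p u σ w z

    reducedRatio? : ∀ p u σ w z → Dec (ReducedRatio p u σ w z)
    reducedRatio? p u σ w (x , y) = coprime? u w ×-dec (+ p ∣ᶻ? (+ u *ᶻ + x -ᶻ signed σ w *ᶻ + y))

    ratioCount : ℕ → ℕ → ℕ → Sign → ℕ → ℕ
    ratioCount p N u σ w = ∑ (square N) (λ z → 𝟙 (reducedRatio? p u σ w z))

    -- For the sign + the reflection y ↦ N + 1 − y turns u x − w y into a sum.
    reflect : Sign → ℕ → ℕ → ℕ
    reflect Sign.- N y = y
    reflect Sign.+ N y = suc N ∸ y

    reflect-≤ : ∀ σ {N y} → 1 ≤ y → y ≤ N → reflect σ N y ≤ N
    reflect-≤ Sign.- 1≤y y≤N = y≤N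
    reflect-≤ Sign.+ {N} 1≤y y≤N = ∸-monoʳ-≤ (suc N) 1≤y

    reflect-injective : ∀ σ {N y y′} → y ≤ N → y′ ≤ N → reflect σ N y ≡ reflect σ N y′ → y ≡ y′
    reflect-injective Sign.- y≤ y′≤ eq = eq
    reflect-injective Sign.+ y≤ y′≤ eq = ∸-cancelˡ-≡ (m≤n⇒m≤1+n y≤) (m≤n⇒m≤1+n y′≤) eq

    reflectedZero : Sign → ℕ → ℕ → ℕ
    reflectedZero Sign.- N w = 0
    reflectedZero Sign.+ N w = w * suc N

    Ratio⇒residue : ∀ {p u w N x y} .{{_ : NonZero p}} σ → y ≤ N → Ratio p u σ w (x , y) →
      (u * x + w * reflect σ N y) % p ≡ reflectedZero σ N w % p
    Ratio⇒residue {p} {u} {w} {N} {x} {y} Sign.- y≤ r =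
      ∣-difference⇒% {p} {u * x + w * y} {0} (subst (+ p ∣ᶻ_) rearrange r)
      where
      ring : ∀ u x w y → u *ᶻ x -ᶻ (-ᶻ w) *ᶻ y ≡ u *ᶻ x +ᶻ w *ᶻ y
      ring = ℤ-Ring.solve-∀
      rearrange : + u *ᶻ + x -ᶻ (-ᶻ + w) *ᶻ + y ≡ + (u * x + w * y) -ᶻ + 0
      rearrange = trans (ring (+ u) (+ x) (+ w) (+ y))
        (trans (sym (pos-linear u x w y)) (sym (ℤₚ.+-identityʳ _)))
    Ratio⇒residue {p} {u} {w} {N} {x} {y} Sign.+ y≤ r =
      ∣-difference⇒% {p} {u * x + w * (suc N ∸ y)} {w * suc N} (subst (+ p ∣ᶻ_) rearrange r)
      where
      ring : ∀ u x w y n → u *ᶻ x -ᶻ w *ᶻ y ≡ u *ᶻ x +ᶻ w *ᶻ (n -ᶻ y) -ᶻ w *ᶻ n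
      ring = ℤ-Ring.solve-∀
      rearrange : + u *ᶻ + x -ᶻ + w *ᶻ + y ≡ + (u * x + w * (suc N ∸ y)) -ᶻ + (w * suc N)
      rearrange = trans (ring (+ u) (+ x) (+ w) (+ y) (+ suc N))
        (cong₂ _-ᶻ_ (sym (trans (pos-linear u x w (suc N ∸ y))
          (cong (λ i → + u *ᶻ + x +ᶻ + w *ᶻ i) (pos-∸ (m≤n⇒m≤1+n y≤)))))
          (sym (ℤₚ.pos-* w (suc N))))

    Ratio-swap : ∀ {p u w x y} σ → Ratio p u σ w (x , y) → Ratio p w σ u (y , x)
    Ratio-swap {p} {u} {w} {x} {y} Sign.+ (divides k eq) = divides (-ᶻ k)
      (trans (ring (+ u) (+ x) (+ w) (+ y)) (trans (cong -ᶻ_ eq) (ℤₚ.neg-distribˡ-* k (+ p))))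
      where
      ring : ∀ u x w y → w *ᶻ y -ᶻ u *ᶻ x ≡ -ᶻ (u *ᶻ x -ᶻ w *ᶻ y)
      ring = ℤ-Ring.solve-∀
    Ratio-swap {p} {u} {w} {x} {y} Sign.- (divides k eq) = divides k
      (trans (ring (+ u) (+ x) (+ w) (+ y)) eq)
      where
      ring : ∀ u x w y → w *ᶻ y -ᶻ (-ᶻ u) *ᶻ x ≡ u *ᶻ x -ᶻ (-ᶻ w) *ᶻ y
      ring = ℤ-Ring.solve-∀

    -- The coordinates s and t are parameters, so that the block length w can be the coefficient of
    -- either coordinate of the square.
    axis-bound : ∀ {p u w N} σ .{{_ : NonZero p}} .{{_ : NonZero w}} {P : ℕ × ℕ → Set}
      (P? : ∀ z → Dec (P z)) (s t : ℕ × ℕ → ℕ) →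
      w * u ≤ p → w * w ≤ p → w ≤ N →
      (∀ {z} → z ∈ square N → s z ≤ N × 1 ≤ t z × t z ≤ N) →
      (∀ {z z′} → s z ≡ s z′ → t z ≡ t z′ → z ≡ z′) →
      (∀ {z} → P z → ReducedRatio p u σ w (s z , t z)) →
      p * w * ∑ (square N) (λ z → 𝟙 (P? z)) ≤ N * N * w + 7 * N * p
    axis-bound {p} {u} {w} {N} σ P? s t wu≤p ww≤p w≤N range st-inj ratio =
      block-bound {p} {u} {w} {N} wu≤p ww≤p w≤N
        (count-residue P? (square-unique N) s (λ z → reflect σ N (t z))
          (λ z∈ → proj₁ (range z∈))
          (λ z∈ → uncurry (reflect-≤ σ) (proj₂ (range z∈)))
          (λ z∈ z′∈ s≡ t≡ → st-inj s≡ (reflect-injective σ (proj₂ (proj₂ (range z∈)))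
            (proj₂ (proj₂ (range z′∈))) t≡))
          (λ Pz → proj₁ (ratio Pz))
          (λ {z} z∈ Pz → Ratio⇒residue {u = u} {w} {N} {s z} {t z} σ
            (proj₂ (proj₂ (range z∈))) (proj₂ (ratio Pz))))

    -- The larger of u and w becomes the block length. If it is u, the two coordinates and the two
    -- coefficients are exchanged.
    ratio-bound : ∀ {p u w s N} σ .{{_ : NonZero p}} → 1 ≤ u → u ≤ s → 1 ≤ w → w ≤ s →
      s * s ≤ p → s ≤ N →
      p * (u ⊔ w) * ratioCount p N u σ w ≤ N * N * (u ⊔ w) + 7 * N * p
    ratio-bound {p} {u} {w} {s} {N} σ {{p≢0}} 1≤u u≤s 1≤w w≤s ss≤p s≤N with ⊔-sel u w
    ... | inj₂ eq rewrite eq = axis-bound {p} {u} {w} {N} σ {{p≢0}} {{>-nonZero 1≤w}}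
      (reducedRatio? p u σ w) proj₁ proj₂
      (≤-trans (*-mono-≤ w≤s u≤s) ss≤p) (≤-trans (*-mono-≤ w≤s w≤s) ss≤p) (≤-trans w≤s s≤N)
      (λ z∈ → let (_ , x≤) , (1≤y , y≤) = ∈-square⁻ z∈ in x≤ , 1≤y , y≤)
      (λ s≡ t≡ → cong₂ _,_ s≡ t≡) (λ r → r)
    ... | inj₁ eq rewrite eq = axis-bound {p} {w} {u} {N} σ {{p≢0}} {{>-nonZero 1≤u}}
      (reducedRatio? p u σ w) proj₂ proj₁
      (≤-trans (*-mono-≤ u≤s w≤s) ss≤p) (≤-trans (*-mono-≤ u≤s u≤s) ss≤p) (≤-trans u≤s s≤N)
      (λ z∈ → let (1≤x , x≤) , (_ , y≤) = ∈-square⁻ z∈ in y≤ , 1≤x , x≤)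
      (λ s≡ t≡ → cong₂ _,_ t≡ s≡)
      (λ (cop , r) → (λ (d∣w , d∣u) → cop (d∣u , d∣w)) , Ratio-swap {u = u} {w} σ r)

    -- Thue's lemma

    SmallRatio : ℕ → ℕ → ℕ × ℕ → Set
    SmallRatio p s z = ∃[ u ] ∃[ w ] ∃[ σ ]
      ((1 ≤ u × u ≤ s) × (1 ≤ w × w ≤ s) × ReducedRatio p u σ w z)

    -- The (s + 1)² pairs of coefficients in [0, s] outnumber the p residues of i x + j y.
    collision : ∀ {p s x y} .{{_ : NonZero p}} → p < suc s * suc s → ∃[ i ] ∃[ j ] ∃[ k ] ∃[ l ]
      ((i ≤ s × j ≤ s) × (k ≤ s × l ≤ s) × ¬ (i ≡ k × j ≡ l) ×
       (i * x + j * y) % p ≡ (k * x + l * y) % p)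
    collision {p} {s} {x} {y} p< with pigeonhole p< f
      where
      f : Fin (suc s * suc s) → Fin p
      f a = let i , j = remQuot {suc s} (suc s) a in (toℕ i * x + toℕ j * y) mod p
    ... | a , b , a<b , fa≡fb =
      toℕ i , toℕ j , toℕ k , toℕ l , (bound i , bound j) , (bound k , bound l) ,
      (λ (i≡k , j≡l) → contradiction
        (cong toℕ (trans (sym (combine-remQuot {suc s} (suc s) a))
          (trans (cong₂ combine (toℕ-injective i≡k) (toℕ-injective j≡l))
            (combine-remQuot {suc s} (suc s) b)))) (<⇒≢ a<b)) ,
      trans (sym (toℕ-fromℕ< _)) (trans (cong toℕ fa≡fb) (toℕ-fromℕ< _))
      where
      i = proj₁ (remQuot {suc s} (suc s) a)
      j = proj₂ (remQuot {suc s} (suc s) a)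
      k = proj₁ (remQuot {suc s} (suc s) b)
      l = proj₂ (remQuot {suc s} (suc s) b)
      bound : (m : Fin (suc s)) → toℕ m ≤ s
      bound m = s≤s⁻¹ (toℕ<n m)

    -- The two combinations are subtracted. Since i ≤ k the coefficient of x is natural, and the
    -- order of j and l decides the sign.
    collision⇒Ratio : ∀ {p s x y i j k l} .{{_ : NonZero p}} → i ≤ k → j ≤ s → k ≤ s → l ≤ s →
      ¬ (i ≡ k × j ≡ l) → (i * x + j * y) % p ≡ (k * x + l * y) % p →
      ∃[ u ] ∃[ w ] ∃[ σ ] (u ≤ s × w ≤ s × ¬ (u ≡ 0 × w ≡ 0) × Ratio p u σ w (x , y))
    collision⇒Ratio {p} {s} {x} {y} {i} {j} {k} {l} i≤k j≤s k≤s l≤s distinct eq with ≤-total j l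
    ... | inj₁ j≤l = k ∸ i , l ∸ j , Sign.- , ≤-trans (m∸n≤m k i) k≤s , ≤-trans (m∸n≤m l j) l≤s ,
      (λ (u≡0 , w≡0) → distinct (≤-antisym i≤k (m∸n≡0⇒m≤n u≡0) , ≤-antisym j≤l (m∸n≡0⇒m≤n w≡0))) ,
      subst (+ p ∣ᶻ_) rearrange (%⇒∣-difference {p} {k * x + l * y} {i * x + j * y} (sym eq))
      where
      ring : ∀ i j k l x y → k *ᶻ x +ᶻ l *ᶻ y -ᶻ (i *ᶻ x +ᶻ j *ᶻ y) ≡
        (k -ᶻ i) *ᶻ x -ᶻ (-ᶻ (l -ᶻ j)) *ᶻ y
      ring = ℤ-Ring.solve-∀
      rearrange : + (k * x + l * y) -ᶻ + (i * x + j * y) ≡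
        + (k ∸ i) *ᶻ + x -ᶻ (-ᶻ + (l ∸ j)) *ᶻ + y
      rearrange = trans (cong₂ _-ᶻ_ (pos-linear k x l y) (pos-linear i x j y))
        (trans (ring (+ i) (+ j) (+ k) (+ l) (+ x) (+ y))
          (sym (cong₂ (λ a b → a *ᶻ + x -ᶻ (-ᶻ b) *ᶻ + y) (pos-∸ i≤k) (pos-∸ j≤l))))
    ... | inj₂ l≤j = k ∸ i , j ∸ l , Sign.+ , ≤-trans (m∸n≤m k i) k≤s , ≤-trans (m∸n≤m j l) j≤s ,
      (λ (u≡0 , w≡0) → distinct (≤-antisym i≤k (m∸n≡0⇒m≤n u≡0) , ≤-antisym (m∸n≡0⇒m≤n w≡0) l≤j)) ,
      subst (+ p ∣ᶻ_) rearrange (%⇒∣-difference {p} {k * x + l * y} {i * x + j * y} (sym eq))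
      where
      ring : ∀ i j k l x y → k *ᶻ x +ᶻ l *ᶻ y -ᶻ (i *ᶻ x +ᶻ j *ᶻ y) ≡
        (k -ᶻ i) *ᶻ x -ᶻ (j -ᶻ l) *ᶻ y
      ring = ℤ-Ring.solve-∀
      rearrange : + (k * x + l * y) -ᶻ + (i * x + j * y) ≡ + (k ∸ i) *ᶻ + x -ᶻ + (j ∸ l) *ᶻ + y
      rearrange = trans (cong₂ _-ᶻ_ (pos-linear k x l y) (pos-linear i x j y))
        (trans (ring (+ i) (+ j) (+ k) (+ l) (+ x) (+ y))
          (sym (cong₂ (λ a b → a *ᶻ + x -ᶻ b *ᶻ + y) (pos-∸ i≤k) (pos-∸ l≤j))))

    -- If u = 0, then p divides w y with both factors strictly between 0 and p.
    Ratio-nonzero : ∀ {p u w x y} σ → Prime p → w < p → 1 ≤ y → y < p →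
      ¬ (u ≡ 0 × w ≡ 0) → Ratio p u σ w (x , y) → 1 ≤ u
    Ratio-nonzero {u = suc _} σ _ _ _ _ _ _ = s≤s z≤n
    Ratio-nonzero {p} {zero} {zero} σ pr w<p 1≤y y<p ≢0 r = contradiction (refl , refl) ≢0
    Ratio-nonzero {p} {zero} {w@(suc _)} {x} {y} σ pr w<p 1≤y y<p ≢0 r =
      contradiction
        (∣⇒≤ (p∣w σ (prime-cancel pr 1≤y y<p (subst (+ p ∣ᶻ_) (ring (+ x) (signed σ w) (+ y)) r))))
          (<⇒≱ w<p)
      where
      ring : ∀ x v y → + 0 *ᶻ x -ᶻ v *ᶻ y ≡ y *ᶻ (-ᶻ v)
      ring = ℤ-Ring.solve-∀
      p∣w : ∀ σ → + p ∣ᶻ -ᶻ signed σ w → p ∣ w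
      p∣w Sign.+ d = ∣⇒∣ᵤ d
      p∣w Sign.- d = ∣⇒∣ᵤ d

    -- The common divisor g of u and w is at most s < p, so it can be cancelled modulo p.
    Ratio⇒SmallRatio : ∀ {p s u w σ x y} → Prime p → s < p →
      1 ≤ u → u ≤ s → 1 ≤ w → w ≤ s → Ratio p u σ w (x , y) → SmallRatio p s (x , y)
    Ratio⇒SmallRatio {p} {s} {u} {w} {σ} {x} {y} pr s<p 1≤u u≤s 1≤w w≤s r =
      u / g , w / g , σ , (positive u 1≤u u′g≡u , ≤-trans (m/n≤m u g) u≤s) ,
      (positive w 1≤w w′g≡w , ≤-trans (m/n≤m w g) w≤s) , coprime-/gcd u w ,
      prime-cancel pr 1≤g (≤-<-trans (∣⇒≤ {{>-nonZero 1≤u}} (gcd[m,n]∣m u w)) (≤-<-trans u≤s s<p))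
        (subst (+ p ∣ᶻ_) rearrange r)
      where
      g = gcd u w
      g≢0 : g ≢ 0
      g≢0 = gcd[m,n]≢0 u w (inj₁ (m<n⇒n≢0 1≤u))
      instance
        g-nonZero : NonZero g
        g-nonZero = ≢-nonZero g≢0
      1≤g : 1 ≤ g
      1≤g = n≢0⇒n>0 g≢0
      u′g≡u : u / g * g ≡ u
      u′g≡u = m/n*n≡m (gcd[m,n]∣m u w)
      w′g≡w : w / g * g ≡ w
      w′g≡w = m/n*n≡m (gcd[m,n]∣n u w)
      positive : ∀ v {q} → 1 ≤ v → q * g ≡ v → 1 ≤ q
      positive v {zero}  1≤v eq = subst (1 ≤_) (sym eq) 1≤v
      positive v {suc q} 1≤v eq = s≤s z≤n
      ring : ∀ g u v x y → g *ᶻ u *ᶻ x -ᶻ g *ᶻ v *ᶻ y ≡ g *ᶻ (u *ᶻ x -ᶻ v *ᶻ y)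
      ring = ℤ-Ring.solve-∀
      rearrange : + u *ᶻ + x -ᶻ signed σ w *ᶻ + y ≡
        + g *ᶻ (+ (u / g) *ᶻ + x -ᶻ signed σ (w / g) *ᶻ + y)
      rearrange = trans (cong₂ (λ a b → a *ᶻ + x -ᶻ b *ᶻ + y)
          (trans (cong +_ (sym (trans (*-comm g (u / g)) u′g≡u))) (ℤₚ.pos-* g (u / g)))
          (trans (cong (signed σ) (sym (trans (*-comm g (w / g)) w′g≡w))) (signed-* σ g (w / g))))
        (ring (+ g) (+ (u / g)) (signed σ (w / g)) (+ x) (+ y))

    thue : ∀ {p s x y} → Prime p → .{{_ : NonZero p}} → s < p → p < suc s * suc s →
      1 ≤ x → x < p → 1 ≤ y → y < p → SmallRatio p s (x , y)
    thue {p} {s} {x} {y} pr s<p p<  1≤x x<p 1≤y y<p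
      with i , j , k , l , (i≤ , j≤) , (k≤ , l≤) , distinct , eq ← collision {p} {s} {x} {y} p<
      = finish (case-≤ (≤-total i k))
      where
      case-≤ : i ≤ k ⊎ k ≤ i →
        ∃[ u ] ∃[ w ] ∃[ σ ] (u ≤ s × w ≤ s × ¬ (u ≡ 0 × w ≡ 0) × Ratio p u σ w (x , y))
      case-≤ (inj₁ i≤k) = collision⇒Ratio {p} {s} {x} {y} i≤k j≤ k≤ l≤ distinct eq
      case-≤ (inj₂ k≤i) = collision⇒Ratio {p} {s} {x} {y} k≤i l≤ i≤ j≤
        (λ (k≡i , l≡j) → distinct (sym k≡i , sym l≡j)) (sym eq)
      finish : ∃[ u ] ∃[ w ] ∃[ σ ] (u ≤ s × w ≤ s × ¬ (u ≡ 0 × w ≡ 0) × Ratio p u σ w (x , y)) →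
        SmallRatio p s (x , y)
      finish (u , w , σ , u≤ , w≤ , ≢0 , r) = Ratio⇒SmallRatio {u = u} {w} {σ} pr s<p
        (Ratio-nonzero {u = u} {w} σ pr (≤-<-trans w≤ s<p) 1≤y y<p ≢0 r) u≤
        -- Positivity of w is that of the first coefficient in the swapped ratio.
        (Ratio-nonzero {u = w} {u} σ pr (≤-<-trans u≤ s<p) 1≤x x<p (λ (w≡0 , u≡0) → ≢0 (u≡0 , w≡0))
          (Ratio-swap {u = u} {w} σ r)) w≤ r

    -- Multiplied by x′, the form w y ∓ u y′ becomes an integer combination of x y - x′ y′ and u x ∓
    -- w x′, both divisible by p; then x′ is cancelled.
    dual-ratio : ∀ {p u w x x′ y y′} σ → Prime p → .{{_ : NonZero p}} → 1 ≤ x′ → x′ < p →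
      Ratio p u σ w (x , x′) → (x * y) % p ≡ (x′ * y′) % p → Ratio p w σ u (y , y′)
    dual-ratio {p} {u} {w} {x} {x′} {y} {y′} σ pr 1≤x′ x′<p (divides k eq) xy≡ with
      divides l eq′ ← %⇒∣-difference {p} {x * y} {x′ * y′} xy≡ =
      prime-cancel pr 1≤x′ x′<p (go σ eq)
      where
      eq″ : + x *ᶻ + y -ᶻ + x′ *ᶻ + y′ ≡ l *ᶻ + p
      eq″ = trans (sym (cong₂ _-ᶻ_ (ℤₚ.pos-* x y) (ℤₚ.pos-* x′ y′))) eq′
      go : ∀ σ → + u *ᶻ + x -ᶻ signed σ w *ᶻ + x′ ≡ k *ᶻ + p →
        + p ∣ᶻ + x′ *ᶻ (+ w *ᶻ + y -ᶻ signed σ u *ᶻ + y′)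
      go Sign.+ eq = divides (+ u *ᶻ l -ᶻ + y *ᶻ k)
        (trans (ring (+ u) (+ w) (+ x) (+ x′) (+ y) (+ y′))
        (trans (cong₂ (λ a b → + u *ᶻ a -ᶻ + y *ᶻ b) eq″ eq) (collect (+ u) (+ y) k l (+ p))))
        where
        ring : ∀ u w x x′ y y′ → x′ *ᶻ (w *ᶻ y -ᶻ u *ᶻ y′) ≡
          u *ᶻ (x *ᶻ y -ᶻ x′ *ᶻ y′) -ᶻ y *ᶻ (u *ᶻ x -ᶻ w *ᶻ x′)
        ring = ℤ-Ring.solve-∀
        collect : ∀ u y k l p → u *ᶻ (l *ᶻ p) -ᶻ y *ᶻ (k *ᶻ p) ≡ (u *ᶻ l -ᶻ y *ᶻ k) *ᶻ p
        collect = ℤ-Ring.solve-∀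
      go Sign.- eq = divides (+ y *ᶻ k -ᶻ + u *ᶻ l)
        (trans (ring (+ u) (+ w) (+ x) (+ x′) (+ y) (+ y′))
        (trans (cong₂ (λ a b → + y *ᶻ b -ᶻ + u *ᶻ a) eq″ eq) (collect (+ u) (+ y) k l (+ p))))
        where
        ring : ∀ u w x x′ y y′ → x′ *ᶻ (w *ᶻ y -ᶻ (-ᶻ u) *ᶻ y′) ≡
          y *ᶻ (u *ᶻ x -ᶻ (-ᶻ w) *ᶻ x′) -ᶻ u *ᶻ (x *ᶻ y -ᶻ x′ *ᶻ y′)
        ring = ℤ-Ring.solve-∀
        collect : ∀ u y k l p → y *ᶻ (k *ᶻ p) -ᶻ u *ᶻ (l *ᶻ p) ≡ (y *ᶻ k -ᶻ u *ᶻ l) *ᶻ p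
        collect = ℤ-Ring.solve-∀

  open Congruence

  -- The multiplicative energy of an interval

  -- A value w is the maximum of at most 2 w pairs: w with it in either position, the diagonal being
  -- counted twice.
  ∑-max : ∀ s (f : ℕ → ℕ) →
    ∑ (interval 1 s) (λ u → ∑ (interval 1 s) (λ w → f (u ⊔ w))) ≤
    2 * ∑ (interval 1 s) (λ w → w * f w)
  ∑-max s f = begin
    ∑ R (λ u → ∑ R (λ w → f (u ⊔ w)))
      ≤⟨ ∑-mono R (λ {u} _ → ∑-mono R (λ {w} _ → split u w)) ⟩
    ∑ R (λ u → ∑ R (λ w → 𝟙 (u ≤? w) * f w + 𝟙 (w ≤? u) * f u))
      ≡⟨ ∑-cong R (λ u → ∑-+ R _ _) ⟩
    ∑ R (λ u → ∑ R (λ w → 𝟙 (u ≤? w) * f w) + ∑ R (λ w → 𝟙 (w ≤? u) * f u))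
      ≡⟨ ∑-+ R _ _ ⟩
    ∑ R (λ u → ∑ R (λ w → 𝟙 (u ≤? w) * f w)) + ∑ R (λ u → ∑ R (λ w → 𝟙 (w ≤? u) * f u))
      ≡⟨ cong (_+ ∑ R (λ u → ∑ R (λ w → 𝟙 (w ≤? u) * f u))) (∑-swap R R _) ⟩
    ∑ R (λ w → ∑ R (λ u → 𝟙 (u ≤? w) * f w)) + ∑ R (λ w → ∑ R (λ u → 𝟙 (u ≤? w) * f w))
      ≤⟨ +-mono-≤ below below ⟩
    ∑ R (λ w → w * f w) + ∑ R (λ w → w * f w)
      ≡⟨ cong (∑ R (λ w → w * f w) +_) (+-identityʳ _) ⟨
    2 * ∑ R (λ w → w * f w) ∎
    where
    open ≤-Reasoning
    R = interval 1 s
    split : ∀ u w → f (u ⊔ w) ≤ 𝟙 (u ≤? w) * f w + 𝟙 (w ≤? u) * f u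
    split u w with ≤-total u w
    ... | inj₁ u≤w = ≤-trans (≤-reflexive (cong f (m≤n⇒m⊔n≡n u≤w)))
      (≤-trans (m≤n*m (f w) (𝟙 (u ≤? w)) {{>-nonZero (𝟙-yes (u ≤? w) u≤w)}}) (m≤m+n _ _))
    ... | inj₂ w≤u = ≤-trans (≤-reflexive (cong f (m≥n⇒m⊔n≡m w≤u)))
      (≤-trans (m≤n*m (f u) (𝟙 (w ≤? u)) {{>-nonZero (𝟙-yes (w ≤? u) w≤u)}}) (m≤n+m _ _))
    below : ∑ R (λ w → ∑ R (λ u → 𝟙 (u ≤? w) * f w)) ≤ ∑ R (λ w → w * f w)
    below = ∑-mono R (λ {w} _ → ≤-trans (≤-reflexive (∑-*ʳ R (f w) _))
      (*-monoˡ-≤ (f w) (∑-injection (_≤? w) (interval-unique 1 s) w pred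
        (λ {u} u∈ u≤w → pred< (proj₁ (∈-interval-1⁻ u∈)) u≤w)
        (λ u∈ v∈ _ _ → pred-inj (proj₁ (∈-interval-1⁻ u∈)) (proj₁ (∈-interval-1⁻ v∈))))))
      where
      pred< : ∀ {u w} → 1 ≤ u → u ≤ w → pred u < w
      pred< {suc u} _ u<w = u<w
      pred-inj : ∀ {u v} → 1 ≤ u → 1 ≤ v → pred u ≡ pred v → u ≡ v
      pred-inj {suc u} {suc v} _ _ eq = cong suc eq

  abstract
    -- Abstract, so that sums over the two signs remain sums and can be exchanged like the others.
    signs : List Sign
    signs = Sign.+ ∷ Sign.- ∷ []

    ∈-signs : ∀ σ → σ ∈ signs
    ∈-signs Sign.+ = here refl
    ∈-signs Sign.- = there (here refl)

    length-signs : length signs ≡ 2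
    length-signs = refl

  residueEquation? : ∀ p .{{_ : NonZero p}} x y x′ y′ → Dec ((x * y) mod p ≡ (x′ * y′) mod p)
  residueEquation? p x y x′ y′ = (x * y) mod p ≟ᶠ (x′ * y′) mod p

  energy : ∀ p .{{_ : NonZero p}} → ℕ → ℕ
  energy p N = ∑ (square N) (λ (x , y) → ∑ (square N) (λ (x′ , y′) →
    𝟙 (residueEquation? p x y x′ y′)))

  -- The weights g t stand for D / t.
  module Weighted {p s N D H : ℕ} (pr : Prime p) .{{_ : NonZero p}}
    (ss≤p : s * s ≤ p) (p<ss : p < suc s * suc s) (s≤N : s ≤ N) (N<p : N < p)
    (g : ℕ → ℕ) .{{_ : NonZero D}} (t*gt≡D : ∀ {t} → 1 ≤ t → t ≤ s → t * g t ≡ D)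
    (∑g≤ : ∑ (interval 1 s) g ≤ H * D) where

    R = interval 1 s

    -- Multiplying by `g t` is the exact division by t, up to the common denominator D.
    weighted : ∀ {t C} → 1 ≤ t → t ≤ s → p * t * C ≤ N * N * t + 7 * N * p →
      p * D * C ≤ N * N * D + 7 * N * p * g t
    weighted {t} {C} 1≤t t≤s C≤ = begin
      p * D * C                        ≡⟨ cong (λ d → p * d * C) (t*gt≡D 1≤t t≤s) ⟨
      p * (t * g t) * C                ≡⟨ regroup p t (g t) C ⟩
      p * t * C * g t                  ≤⟨ *-monoˡ-≤ (g t) C≤ ⟩
      (N * N * t + 7 * N * p) * g t    ≡⟨ expand N t p (g t) ⟩
      N * N * (t * g t) + 7 * N * p * g t  ≡⟨ cong (λ d → N * N * d + 7 * N * p * g t) (t*gt≡D 1≤t t≤s) ⟩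
      N * N * D + 7 * N * p * g t      ∎
      where
      open ≤-Reasoning
      regroup : ∀ p t g C → p * (t * g) * C ≡ p * t * C * g
      regroup = solve-∀
      expand : ∀ N t p g → (N * N * t + 7 * N * p) * g ≡ N * N * (t * g) + 7 * N * p * g
      expand = solve-∀

    -- The sum of D / T over all small reduced ratios of z, not over a chosen one. Thue's lemma
    -- supplies at least one term, and the sum over z can then be exchanged with those over u, w and
    -- the sign.
    weight : ℕ × ℕ → ℕ
    weight z = ∑ R (λ u → ∑ R (λ w → ∑ signs (λ σ →
      g (u ⊔ w) * 𝟙 (reducedRatio? p u σ w z))))

    1≤⊔ : ∀ {u w} → 1 ≤ u → 1 ≤ u ⊔ w
    1≤⊔ {u} {w} 1≤u = ≤-trans 1≤u (m≤m⊔n u w)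

    ∈-R : ∀ {u} → 1 ≤ u → u ≤ s → u ∈ R
    ∈-R 1≤u u≤s = ∈-interval⁺ 1 s 1≤u (s≤s u≤s)

    solutions : ℕ × ℕ → ℕ
    solutions (x , x′) = ∑ (square N) (λ (y , y′) → 𝟙 (residueEquation? p x y x′ y′))

    mod⇒% : ∀ {a b} → a mod p ≡ b mod p → a % p ≡ b % p
    mod⇒% eq = trans (sym (toℕ-fromℕ< _)) (trans (cong toℕ eq) (toℕ-fromℕ< _))

    solutions≤ratioCount : ∀ {x x′ u w} σ → 1 ≤ x′ → x′ < p → ReducedRatio p u σ w (x , x′) →
      solutions (x , x′) ≤ ratioCount p N w σ u
    solutions≤ratioCount {x} {x′} {u} {w} σ 1≤x′ x′<p (cop , r) = ∑-mono (square N) pointwise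
      where
      dual : ∀ {y y′} → (x * y) mod p ≡ (x′ * y′) mod p → ReducedRatio p w σ u (y , y′)
      dual {y} {y′} eq = (λ (d∣w , d∣u) → cop (d∣u , d∣w)) ,
        dual-ratio {p} {u} {w} {x} {x′} {y} {y′} σ pr 1≤x′ x′<p r (mod⇒% {x * y} {x′ * y′} eq)
      pointwise : ∀ {z} → z ∈ square N →
        𝟙 (residueEquation? p x (proj₁ z) x′ (proj₂ z)) ≤ 𝟙 (reducedRatio? p w σ u z)
      pointwise {y , y′} _ = 𝟙-mono (residueEquation? p x y x′ y′) (reducedRatio? p w σ u (y , y′)) dual

    g≤weight : ∀ {z u w} σ → 1 ≤ u → u ≤ s → 1 ≤ w → w ≤ s → ReducedRatio p u σ w z →
      g (w ⊔ u) ≤ weight z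
    g≤weight {z} {u} {w} σ 1≤u u≤ 1≤w w≤ r = begin
      g (w ⊔ u)                                  ≡⟨ cong g (⊔-comm w u) ⟩
      g (u ⊔ w)                                  ≤⟨ m≤m*n (g (u ⊔ w)) _
                                                      {{>-nonZero (𝟙-yes (reducedRatio? p u σ w z) r)}} ⟩
      term u w σ                                 ≤⟨ ∑-term (term u w) (∈-signs σ) ⟩
      ∑ signs (term u w)                         ≤⟨ ∑-term (λ w → ∑ signs (term u w)) (∈-R 1≤w w≤) ⟩
      ∑ R (λ w → ∑ signs (term u w))             ≤⟨ ∑-term (λ u → ∑ R (λ w → ∑ signs (term u w)))
                                                      (∈-R 1≤u u≤) ⟩
      weight z                                   ∎
      where
      open ≤-Reasoning
      term : ℕ → ℕ → Sign → ℕ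
      term u w σ = g (u ⊔ w) * 𝟙 (reducedRatio? p u σ w z)

    smallRatio-bound : ∀ {x x′} → 1 ≤ x′ → x′ < p → SmallRatio p s (x , x′) →
      p * D * solutions (x , x′) ≤ N * N * D + 7 * N * p * weight (x , x′)
    smallRatio-bound {x} {x′} 1≤x′ x′<p (u , w , σ , (1≤u , u≤) , (1≤w , w≤) , r) =
      ≤-trans (*-monoʳ-≤ (p * D) (solutions≤ratioCount {x} {x′} {u} {w} σ 1≤x′ x′<p r))
      (≤-trans (weighted {w ⊔ u} {ratioCount p N w σ u} (1≤⊔ 1≤w) (⊔-lub w≤ u≤)
             (ratio-bound {p} {w} {u} {s} {N} σ 1≤w w≤ 1≤u u≤ ss≤p s≤N))
      (+-monoʳ-≤ (N * N * D) (*-monoʳ-≤ (7 * N * p) (g≤weight {x , x′} {u} {w} σ 1≤u u≤ 1≤w w≤ r))))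

    solutions-bound : ∀ {z} → z ∈ square N →
      p * D * solutions z ≤ N * N * D + 7 * N * p * weight z
    solutions-bound {x , x′} z∈ =
      let (1≤x , x≤) , (1≤x′ , x′≤) = ∈-square⁻ z∈ in
      smallRatio-bound {x} {x′} 1≤x′ (≤-<-trans x′≤ N<p)
        (thue {p} {s} {x} {x′} pr (≤-<-trans s≤N N<p) p<ss
          1≤x (≤-<-trans x≤ N<p) 1≤x′ (≤-<-trans x′≤ N<p))

    ∑t*f : ∀ (f : ℕ → ℕ) → ∑ R (λ t → t * (g t * f t)) ≤ D * ∑ R f
    ∑t*f f = ≤-trans (∑-mono R (λ {t} t∈ → let 1≤t , t≤ = ∈-interval-1⁻ t∈ in
        ≤-reflexive (trans (sym (*-assoc t (g t) (f t))) (cong (_* f t) (t*gt≡D 1≤t t≤)))))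
      (≤-reflexive (∑-*ˡ R D f))

    -- After the exchange, `ratio-bound` applies to each (u, w, σ). The factor t gained from the
    -- pairs with maximum t cancels one of the two weights `g t`. The constants are 4 = 2 · 2, from
    -- the signs and from `∑-max`, and 28 = 4 · 7.
    ∑-weight : p * ∑ (square N) weight ≤ 4 * (N * N * s * D) + 28 * (N * p * H * D)
    ∑-weight = *-cancelˡ-≤ D (begin
      D * (p * ∑ (square N) weight)
        ≡⟨ trans (sym (*-assoc D p _)) (cong (_* ∑ (square N) weight) (*-comm D p)) ⟩
      p * D * ∑ (square N) weight
        ≡⟨ cong (p * D *_) exchange ⟩
      p * D * ∑ R (λ u → ∑ R (λ w → ∑ signs (λ σ → g (u ⊔ w) * ratioCount p N u σ w)))
        ≡⟨ push ⟩
      ∑ R (λ u → ∑ R (λ w → ∑ signs (λ σ → p * D * (g (u ⊔ w) * ratioCount p N u σ w))))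
        ≤⟨ ∑-mono R (λ {u} u∈ → ∑-mono R (λ {w} w∈ → ≤-trans (∑-mono signs (λ {σ} _ → each u∈ w∈ σ))
             (≤-reflexive (trans (∑-const signs _) (cong (_* f (u ⊔ w)) length-signs))))) ⟩
      ∑ R (λ u → ∑ R (λ w → 2 * f (u ⊔ w)))
        ≤⟨ ∑-max s (λ t → 2 * f t) ⟩
      2 * ∑ R (λ t → t * (2 * f t))
        ≡⟨ cong (2 *_) (trans (∑-cong R (λ t → reorder t (g t) (h t))) (∑-*ˡ R 2 _)) ⟩
      2 * (2 * ∑ R (λ t → t * (g t * h t)))
        ≤⟨ *-monoʳ-≤ 2 (*-monoʳ-≤ 2 (∑t*f h)) ⟩
      2 * (2 * (D * ∑ R h))
        ≤⟨ *-monoʳ-≤ 2 (*-monoʳ-≤ 2 (*-monoʳ-≤ D ∑h≤)) ⟩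
      2 * (2 * (D * (s * (N * N * D) + 7 * N * p * (H * D))))
        ≡⟨ collect D s N p H ⟩
      D * (4 * (N * N * s * D) + 28 * (N * p * H * D)) ∎)
      where
      open ≤-Reasoning
      h f : ℕ → ℕ
      h t = N * N * D + 7 * N * p * g t
      f t = g t * h t
      C : ℕ → ℕ → Sign → ℕ
      C u w σ = ratioCount p N u σ w
      exchange : ∑ (square N) weight ≡ ∑ R (λ u → ∑ R (λ w → ∑ signs (λ σ → g (u ⊔ w) * C u w σ)))
      exchange = trans (∑-swap (square N) R _) (∑-cong R λ u →
        trans (∑-swap (square N) R _) (∑-cong R λ w →
        trans (∑-swap (square N) signs _) (∑-cong signs λ σ → ∑-*ˡ (square N) (g (u ⊔ w)) _)))
      push : p * D * ∑ R (λ u → ∑ R (λ w → ∑ signs (λ σ → g (u ⊔ w) * C u w σ))) ≡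
        ∑ R (λ u → ∑ R (λ w → ∑ signs (λ σ → p * D * (g (u ⊔ w) * C u w σ))))
      push = sym (trans (∑-cong R λ u → trans (∑-cong R λ w → ∑-*ˡ signs (p * D) _)
        (∑-*ˡ R (p * D) _)) (∑-*ˡ R (p * D) _))
      each : ∀ {u w} → u ∈ R → w ∈ R → ∀ σ → p * D * (g (u ⊔ w) * C u w σ) ≤ f (u ⊔ w)
      each {u} {w} u∈ w∈ σ with ∈-interval-1⁻ u∈ | ∈-interval-1⁻ w∈
      ... | 1≤u , u≤ | 1≤w , w≤ = begin
        p * D * (g (u ⊔ w) * C u w σ)     ≡⟨ regroup (p * D) (g (u ⊔ w)) (C u w σ) ⟩
        g (u ⊔ w) * (p * D * C u w σ)     ≤⟨ *-monoʳ-≤ (g (u ⊔ w)) (weighted (1≤⊔ 1≤u) (⊔-lub u≤ w≤)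
                                               (ratio-bound {p} {u} {w} {s} {N} σ 1≤u u≤ 1≤w w≤ ss≤p s≤N)) ⟩
        f (u ⊔ w)                         ∎
        where
        regroup : ∀ a b c → a * (b * c) ≡ b * (a * c)
        regroup = solve-∀
      reorder : ∀ t g h → t * (2 * (g * h)) ≡ 2 * (t * (g * h))
      reorder = solve-∀
      ∑h≤ : ∑ R h ≤ s * (N * N * D) + 7 * N * p * (H * D)
      ∑h≤ = begin
        ∑ R h
          ≡⟨ ∑-+ R _ _ ⟩
        ∑ R (λ _ → N * N * D) + ∑ R (λ t → 7 * N * p * g t)
          ≡⟨ cong₂ _+_ (∑-interval-const 1 s (N * N * D)) (∑-*ˡ R (7 * N * p) g) ⟩
        s * (N * N * D) + 7 * N * p * ∑ R g
          ≤⟨ +-monoʳ-≤ _ (*-monoʳ-≤ (7 * N * p) ∑g≤) ⟩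
        s * (N * N * D) + 7 * N * p * (H * D) ∎
      collect : ∀ D s N p H → 2 * (2 * (D * (s * (N * N * D) + 7 * N * p * (H * D)))) ≡
        D * (4 * (N * N * s * D) + 28 * (N * p * H * D))
      collect = solve-∀

    -- Regroups the quadruples from (x, y), (x′, y′) to (x, x′), (y, y′) by exchanging the two
    -- middle sums.
    energy≡ : energy p N ≡ ∑ (square N) solutions
    energy≡ = trans (∑-cartesianProduct I I _)
      (trans (∑-cong I λ x → trans (∑-cong I λ y → ∑-cartesianProduct I I _) (∑-swap I I _))
      (trans (∑-cong I λ x → ∑-cong I λ x′ →
        sym (∑-cartesianProduct I I (λ (y , y′) → 𝟙 (residueEquation? p x y x′ y′))))
      (sym (∑-cartesianProduct I I _))))
      where I = interval 1 N

    energy-upper : p * energy p N ≤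
      N * N * (N * N) + 28 * (N * N * (N * s)) + 196 * (N * N * (p * H))
    energy-upper = *-cancelˡ-≤ D (begin
      D * (p * energy p N)
        ≡⟨ cong (λ e → D * (p * e)) energy≡ ⟩
      D * (p * ∑ (square N) solutions)
        ≡⟨ trans (sym (*-assoc D p _)) (trans (cong (_* ∑ (square N) solutions) (*-comm D p))
             (sym (∑-*ˡ (square N) (p * D) _))) ⟩
      ∑ (square N) (λ z → p * D * solutions z)
        ≤⟨ ∑-mono (square N) solutions-bound ⟩
      ∑ (square N) (λ z → N * N * D + 7 * N * p * weight z)
        ≡⟨ trans (∑-+ (square N) _ _) (cong₂ _+_
             (trans (∑-const (square N) (N * N * D)) (cong (_* (N * N * D)) (length-square N)))
             (trans (∑-*ˡ (square N) (7 * N * p) weight) (*-assoc (7 * N) p _))) ⟩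
      N * N * (N * N * D) + 7 * N * (p * ∑ (square N) weight)
        ≤⟨ +-monoʳ-≤ _ (*-monoʳ-≤ (7 * N) ∑-weight) ⟩
      N * N * (N * N * D) + 7 * N * (4 * (N * N * s * D) + 28 * (N * p * H * D))
        -- The constants arise as 28 = 7 · 4 and 196 = 7 · 28.
        ≡⟨ collect N D s p H ⟩
      D * (N * N * (N * N) + 28 * (N * N * (N * s)) + 196 * (N * N * (p * H))) ∎)
      where
      open ≤-Reasoning
      collect : ∀ N D s p H →
        N * N * (N * N * D) + 7 * N * (4 * (N * N * s * D) + 28 * (N * p * H * D)) ≡
        D * (N * N * (N * N) + 28 * (N * N * (N * s)) + 196 * (N * N * (p * H)))
      collect = solve-∀

  -- Choice of the parameters

  unique-length-≤ : ∀ {p} {as : List (Fin p)} → Unique as → length as ≤ p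
  unique-length-≤ {p} {as} u = ≤-trans
    (≤-reflexive (sym (trans (∑-const as 1) (*-identityʳ (length as)))))
    (∑-injection {P = λ _ → ⊤} (λ _ → yes tt) u p toℕ (λ {a} _ _ → toℕ<n a) (λ _ _ _ _ → toℕ-injective))

  crossing : ∀ (f : ℕ → ℕ) n {p} → f 0 ≤ p → p < f n → ∃[ i ] (f i ≤ p × p < f (suc i))
  crossing f zero    {p} f0≤p p<f0 with () ← <⇒≱ p<f0 f0≤p
  crossing f (suc n) {p} f0≤p p<f with ≤-<-connex (f n) p
  ... | inj₁ fn≤p = n , fn≤p , p<f
  ... | inj₂ p<fn = crossing f n f0≤p p<fn

  residue : ∀ p .{{_ : NonZero p}} → ℕ × ℕ → Fin p
  residue p (x , y) = (x * y) mod p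

  residues : ∀ p .{{_ : NonZero p}} → ℕ → List (Fin p)
  residues p N = deduplicate _≟ᶠ_ (map (residue p) (square N))

  residues-unique : ∀ p .{{_ : NonZero p}} N → Unique (residues p N)
  residues-unique p N = deduplicate-! _≟ᶠ_ (map (residue p) (square N))

  ∈-residues⁺ : ∀ p .{{_ : NonZero p}} N {z} → z ∈ square N → residue p z ∈ residues p N
  ∈-residues⁺ p N z∈ = ∈-deduplicate⁺ _≟ᶠ_ (∈-map⁺ (residue p) z∈)

  ∈-residues⁻ : ∀ p .{{_ : NonZero p}} N {a} → a ∈ residues p N →
    ∃[ z ] (z ∈ square N × a ≡ residue p z)
  ∈-residues⁻ p N a∈ = ∈-map⁻ (residue p) (∈-deduplicate⁻ _≟ᶠ_ (map (residue p) (square N)) a∈)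

  -- s = ⌊√p⌋, h = ⌊s / 2⌋ − 1 and B = ⌊log₄ p⌋ − 1; the energy method is applied with N = h B.
  record Parameters (B₀ p : ℕ) : Set where
    field
      B h s    : ℕ
      B₀≤B     : B₀ ≤ B
      3≤B      : 3 ≤ B
      4^B≤p    : 2 ^ (2 * suc B) ≤ p
      p<4^B    : p < 2 ^ (2 * suc (suc B))
      hh<p     : 2 * (suc h * suc h) < p
      ss≤p     : s * s ≤ p
      p<ss     : p < suc s * suc s
      s≤N      : s ≤ h * B
      N<p      : h * B < p
      s≤3h     : s ≤ 3 * h
      p≤16hh   : p ≤ 16 * (h * h)
      1≤h      : 1 ≤ h

  -- With h + 1 = ⌊s / 2⌋ one has 4 (h + 1)² ≤ p, which leaves the room needed to certify h below
  -- √p, while s ≤ 3 h and p ≤ 16 h² keep h of order √p.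
  parameters : ∀ B₀ {p} → 3 ≤ B₀ → 2 ^ (2 * suc B₀) ≤ p → Parameters B₀ p
  parameters B₀ {p} 3≤B₀ 4^B₀≤p = build (crossing f p f0≤p p<fp) (crossing sq (suc p) z≤n p<sq)
    where
    open ≤-Reasoning
    f sq : ℕ → ℕ
    f i  = 2 ^ (2 * suc i)
    sq i = i * i
    f-mono : ∀ {i j} → i ≤ j → f i ≤ f j
    f-mono i≤j = ^-monoʳ-≤ 2 (*-monoʳ-≤ 2 (s≤s i≤j))
    f0≤p : f 0 ≤ p
    f0≤p = ≤-trans (f-mono {0} {B₀} z≤n) 4^B₀≤p
    p<fp : p < f p
    p<fp = <-≤-trans (n<2^n p) (^-monoʳ-≤ 2 (≤-trans (n≤1+n p) (m≤n*m (suc p) 2)))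
    p<sq : p < sq (suc p)
    p<sq = ≤-trans (m≤m+n (suc p) (p * suc p)) ≤-refl

    build : ∃[ B ] (f B ≤ p × p < f (suc B)) → ∃[ s ] (sq s ≤ p × p < sq (suc s)) → Parameters B₀ p
    build (B , 4^B≤p , p<4^B) (s , ss≤p , p<ss) = half (s / 2) refl
      where
      B₀≤B : B₀ ≤ B
      B₀≤B = ≮⇒≥ λ B<B₀ → <⇒≱ p<4^B (≤-trans (f-mono B<B₀) 4^B₀≤p)
      3≤B : 3 ≤ B
      3≤B = ≤-trans 3≤B₀ B₀≤B
      2^B≤s : 2 ^ suc B ≤ s
      2^B≤s = ≮⇒≥ λ s<2^B → <⇒≱ p<ss (begin
        suc s * suc s            ≤⟨ *-mono-≤ s<2^B s<2^B ⟩
        2 ^ suc B * 2 ^ suc B    ≡⟨ cong (2 ^ suc B *_) (*-identityʳ (2 ^ suc B)) ⟨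
        (2 ^ suc B) ^ 2          ≡⟨ ^-*-assoc 2 (suc B) 2 ⟩
        2 ^ (suc B * 2)          ≡⟨ cong (2 ^_) (*-comm (suc B) 2) ⟩
        2 ^ (2 * suc B)          ≤⟨ 4^B≤p ⟩
        p                        ∎)
      s≤1+2q : s ≤ 1 + s / 2 * 2
      s≤1+2q = ≤-trans (≤-reflexive (m≡m%n+[m/n]*n s 2)) (+-monoˡ-≤ (s / 2 * 2) (s≤s⁻¹ (m%n<n s 2)))
      2q≤s : s / 2 * 2 ≤ s
      2q≤s = m/n*n≤m s 2

      half : ∀ q → s / 2 ≡ q → Parameters B₀ p
      half zero    q≡ with () ← <⇒≱
        (≤-trans (s≤s 3≤B) (≤-trans (≤-trans (n<2^n B) (^-monoʳ-≤ 2 (n≤1+n B))) 2^B≤s))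
        (≤-trans (subst (λ q → s ≤ 1 + q * 2) q≡ s≤1+2q) (s≤s z≤n))
      half (suc h) q≡ = record
        { B = B ; h = h ; s = s
        ; B₀≤B = B₀≤B ; 3≤B = 3≤B ; 4^B≤p = 4^B≤p ; p<4^B = p<4^B
        ; hh<p = <-≤-trans (m<m+n (2 * (suc h * suc h)) (s≤s z≤n))
            (≤-trans (≤-reflexive (double h)) 2c2c≤p)
        ; ss≤p = ss≤p ; p<ss = p<ss
        ; s≤N = ≤-trans s≤3h (≤-trans (≤-reflexive (*-comm 3 h)) (*-monoʳ-≤ h 3≤B))
        ; N<p = <-≤-trans (*-mono-< (n<1+n h) (s≤s B≤h))
            (≤-trans (*-mono-≤ (m≤m*n (suc h) 2) (m≤m*n (suc h) 2)) 2c2c≤p)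
        ; s≤3h = s≤3h
        ; p≤16hh = <⇒≤ (<-≤-trans p<ss (≤-trans (*-mono-≤ 1+s≤4h 1+s≤4h) (≤-reflexive (sixteen h))))
        ; 1≤h = ≤-trans (s≤s z≤n) 3≤h
        }
        where
        2c2c≤p : suc h * 2 * (suc h * 2) ≤ p
        2c2c≤p = ≤-trans (*-mono-≤ 2c≤s 2c≤s) ss≤p
          where
          2c≤s : suc h * 2 ≤ s
          2c≤s = subst (λ q → q * 2 ≤ s) q≡ 2q≤s
        double : ∀ h → 2 * (suc h * suc h) + 2 * (suc h * suc h) ≡ suc h * 2 * (suc h * 2)
        double = solve-∀
        sixteen : ∀ h → 4 * h * (4 * h) ≡ 16 * (h * h)
        sixteen = solve-∀
        s≤2h+3 : s ≤ 3 + 2 * h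
        s≤2h+3 = subst (s ≤_) (cong (3 +_) (*-comm h 2)) (subst (λ q → s ≤ 1 + q * 2) q≡ s≤1+2q)
        B≤h : B ≤ h
        -- From 2^(B+1) ≤ s < 2 (h + 2) follows B < 2^B ≤ h + 1. The bound B ≤ h is what keeps N = h
        -- B below p.
        B≤h = s≤s⁻¹ (≤-trans (n<2^n B) (s≤s⁻¹ (*-cancelˡ-< 2 (2 ^ B) (suc (suc h)) (begin-strict
          2 ^ suc B          ≤⟨ 2^B≤s ⟩
          s                  ≤⟨ s≤2h+3 ⟩
          3 + 2 * h          <⟨ n<1+n _ ⟩
          4 + 2 * h          ≡⟨ four h ⟩
          2 * suc (suc h)    ∎))))
          where
          four : ∀ h → 4 + 2 * h ≡ 2 * suc (suc h)
          four = solve-∀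
        3≤h : 3 ≤ h
        3≤h = ≤-trans 3≤B B≤h
        s≤3h : s ≤ 3 * h
        s≤3h = ≤-trans s≤2h+3 (+-monoˡ-≤ (2 * h) 3≤h)
        1+s≤4h : suc s ≤ 4 * h
        1+s≤4h = ≤-trans (s≤s s≤3h) (+-monoˡ-≤ (3 * h) (≤-trans (s≤s z≤n) 3≤h))

  abstract
    -- The relative error of the energy is `deficit` / B: the term 28 N³ s contributes 28 · 3
    -- because s ≤ 3 h, and 196 N² p H contributes 196 · 64 because p ≤ 16 h² and H ≤ 4 B. It is
    -- abstract so that the numeral is not unfolded.
    deficit : ℕ
    deficit = 28 * 3 + 196 * 64

    deficit≡ : deficit ≡ 28 * 3 + 196 * 64
    deficit≡ = refl

    1≤deficit : 1 ≤ deficit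
    1≤deficit = s≤s z≤n

  -- With n classes reached and r missed, cancelling B n leaves B r ≤ K n, so r / n is at most K / B
  -- ≤ 1 / b.
  few-missing : ∀ {b B K n r} → 1 ≤ K → K * b ≤ B →
    B * (n + r) ≤ n * (B + K) → b * r ≤ n
  few-missing {b} {B} {K} {n} {r} 1≤K Kb≤B le = *-cancelˡ-≤ K {{>-nonZero 1≤K}}
    (begin
      K * (b * r)    ≡⟨ *-assoc K b r ⟨
      K * b * r      ≤⟨ *-monoˡ-≤ r Kb≤B ⟩
      B * r            ≤⟨ +-cancelˡ-≤ (B * n) _ _ (≤-trans (≤-reflexive (sym (*-distribˡ-+ B n r)))
                              (≤-trans le (≤-reflexive (expand n B K)))) ⟩
      K * n            ∎)
    where
    open ≤-Reasoning
    expand : ∀ n B K → n * (B + K) ≡ B * n + K * n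
    expand = solve-∀

  combine-errors : ∀ a b {M X Y B} → B * X ≤ 3 * M → B * Y ≤ 64 * M →
    B * (M + a * X + b * Y) ≤ M * (B + (a * 3 + b * 64))
  combine-errors a b {M} {X} {Y} {B} BX≤ BY≤ = begin
    B * (M + a * X + b * Y)                   ≡⟨ expand B M a X b Y ⟩
    B * M + a * (B * X) + b * (B * Y)         ≤⟨ +-mono-≤ (+-monoʳ-≤ (B * M) (*-monoʳ-≤ a BX≤))
                                                   (*-monoʳ-≤ b BY≤) ⟩
    B * M + a * (3 * M) + b * (64 * M)        ≡⟨ collect B M a b ⟩
    M * (B + (a * 3 + b * 64))                ∎
    where
    open ≤-Reasoning
    expand : ∀ B M a X b Y → B * (M + a * X + b * Y) ≡ B * M + a * (B * X) + b * (B * Y)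
    expand = solve-∀
    collect : ∀ B M a b → B * M + a * (3 * M) + b * (64 * M) ≡ M * (B + (a * 3 + b * 64))
    collect = solve-∀

  module _ {B₀ p : ℕ} .{{_ : NonZero p}} (pr : Prime p) (ps : Parameters B₀ p) where
    open Parameters ps
    open ≤-Reasoning

    private
      N = h * B
      H = 2 * suc (suc B)
      M = N * N * (N * N)

      instance
        s!≢0 : NonZero (s !)
        s!≢0 = s !≢0

    harmonic≤ : ∑ (interval 1 s) (factorialOver s) ≤ H * s !
    harmonic≤ = ≤-trans (∑-interval-mono 1 (factorialOver s) s≤mersenne)
      (harmonic-upper (factorialOver s) t*factorialOver≤ H)
      where
      -- Since s ≤ N < p < 2^H, the H dyadic blocks below 2^H cover [1, s].
      s≤mersenne : s ≤ mersenne H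
      s≤mersenne = s≤s⁻¹ (≤-trans (≤-<-trans (≤-trans s≤N (<⇒≤ N<p)) p<4^B)
        (≤-reflexive (sym (1+mersenne H))))

    energy≤ : B * (p * energy p N) ≤ M * (B + deficit)
    energy≤ = begin
      B * (p * energy p N)
        ≤⟨ *-monoʳ-≤ B (Weighted.energy-upper pr ss≤p p<ss s≤N N<p
             (factorialOver s) t*factorialOver≡ harmonic≤) ⟩
      B * (M + 28 * (N * N * (N * s)) + 196 * (N * N * (p * H)))
        ≤⟨ combine-errors 28 196 {M} {N * N * (N * s)} {N * N * (p * H)} {B} Ns≤ pH≤ ⟩
      M * (B + (28 * 3 + 196 * 64))
        ≡⟨ cong (λ d → M * (B + d)) deficit≡ ⟨
      M * (B + deficit) ∎
      where
      Ns≤ : B * (N * N * (N * s)) ≤ 3 * M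
      Ns≤ = begin
        B * (N * N * (N * s))          ≡⟨ regroup B N s ⟩
        N * N * N * (s * B)            ≤⟨ *-monoʳ-≤ (N * N * N) (*-monoˡ-≤ B s≤3h) ⟩
        N * N * N * (3 * h * B)        ≡⟨ cong (N * N * N *_) (*-assoc 3 h B) ⟩
        N * N * N * (3 * N)            ≡⟨ collect N ⟩
        3 * M                          ∎
        where
        regroup : ∀ B N s → B * (N * N * (N * s)) ≡ N * N * N * (s * B)
        regroup = solve-∀
        collect : ∀ N → N * N * N * (3 * N) ≡ 3 * (N * N * (N * N))
        collect = solve-∀
      pH≤ : B * (N * N * (p * H)) ≤ 64 * M
      pH≤ = begin
        B * (N * N * (p * H))                        ≡⟨ regroup B N p H ⟩
        N * N * (p * (H * B))                        ≤⟨ *-monoʳ-≤ (N * N)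
                                                          (*-mono-≤ p≤16hh (*-monoˡ-≤ B H≤)) ⟩
        N * N * (16 * (h * h) * (4 * B * B))         ≡⟨ collect (N * N) h B ⟩
        64 * (N * N * (N * N))                       ∎
        where
        regroup : ∀ B N p H → B * (N * N * (p * H)) ≡ N * N * (p * (H * B))
        regroup = solve-∀
        collect : ∀ a h B → a * (16 * (h * h) * (4 * B * B)) ≡ 64 * (a * (h * B * (h * B)))
        collect = solve-∀
        H≤ : H ≤ 4 * B
        H≤ = begin
          2 * (2 + B)       ≤⟨ *-monoʳ-≤ 2 (+-monoˡ-≤ B (≤-trans (n≤1+n 2) 3≤B)) ⟩
          2 * (B + B)       ≡⟨ four B ⟩
          4 * B             ∎
          where
          four : ∀ B → 2 * (B + B) ≡ 4 * B
          four = solve-∀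

    -- M is the square of the number N² of points, hence at most the number of classes times the
    -- energy. The energy estimate turns this into the claim once M is cancelled.
    many-residues : B * p ≤ length (residues p N) * (B + deficit)
    many-residues = *-cancelˡ-≤ M (begin
      M * (B * p)                                 ≡⟨ *-comm M (B * p) ⟩
      B * p * M                                   ≤⟨ *-monoʳ-≤ (B * p) M≤ ⟩
      B * p * (length (residues p N) * energy p N)  ≡⟨ regroup B p (length (residues p N)) (energy p N) ⟩
      length (residues p N) * (B * (p * energy p N))  ≤⟨ *-monoʳ-≤ (length (residues p N)) energy≤ ⟩
      length (residues p N) * (M * (B + deficit))  ≡⟨ reorder (length (residues p N)) M (B + deficit) ⟩
      M * (length (residues p N) * (B + deficit))  ∎)
      where
      instance
        N≢0 : NonZero N
        N≢0 = m*n≢0 h B {{>-nonZero 1≤h}} {{>-nonZero (≤-trans (s≤s z≤n) 3≤B)}}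
        NN≢0 : NonZero (N * N)
        NN≢0 = m*n≢0 N N
        M≢0 : NonZero M
        M≢0 = m*n≢0 (N * N) (N * N)
      M≤ : M ≤ length (residues p N) * energy p N
      M≤ = subst (λ n → n * n ≤ length (residues p N) * energy p N) (length-square N)
        (energy-bound _≟ᶠ_ (square N) (residue p) (residues-unique p N) (∈-residues⁺ p N))
      regroup : ∀ B p l E → B * p * (l * E) ≡ l * (B * (p * E))
      regroup = solve-∀
      reorder : ∀ l M c → l * (M * c) ≡ M * (l * c)
      reorder = solve-∀

open import Algebra.Bundles using (CommutativeRing)
open import Data.Fin.Base using (Fin; toℕ) renaming (zero to fzero; suc to fsuc)
open import Data.Fin.Properties using (toℕ≤pred[n])
open import Data.Integer.Base as ℤ using (+_; -[1+_])
import Data.Integer.Properties as ℤₚ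
open import Data.List.Base using (length)
open import Data.List.Relation.Unary.All using (tabulate)
open import Data.Nat.Base as ℕ using (ℕ; zero; suc; NonZero; z≤n; s≤s; _!)
open import Data.Nat.Coprimality using (Coprime)
open import Data.Nat.Divisibility using (_∣_; ∣1⇒≡1; ∣m+n∣m⇒∣n; ∣n⇒∣m*n)
open import Data.Nat.Primality using (Prime)
open import Data.Nat.Properties as ℕₚ using (_!≢0)
open import Data.Nat.Tactic.RingSolver using (solve-∀)
open import Data.Product.Base using (_×_; _,_; ∃-syntax)
open import Data.Rational.Base as ℚ using (ℚ; 0ℚ; 1ℚ; ½; mkℚ; _/_; ↧ₙ_; *≤*; *<*)
import Data.Rational.Properties as ℚₚ
import Data.Rational.Unnormalised.Base as ℚᵘ
import Data.Rational.Unnormalised.Properties as ℚᵘₚ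
open import Data.Sum.Base using (inj₁; inj₂)
open import Function.Base using (_∘_)
open import Relation.Binary.PropositionalEquality
open import Relation.Nullary using (contradiction)

open import Algebra.Properties.Semiring.Exp
  (CommutativeRing.semiring ℚₚ.+-*-commutativeRing) using () renaming (_^_ to _^ℚ_)
open import Algebra.Definitions.RawMonoid ℚ.+-0-rawMonoid using () renaming (sum to sumℚ)

open import Defs
open Counting using
  ( ∑; interval; ∑-interval-mono; n<2^n; power-bound; ∈-square⁻; harmonic-lower; mersenne; 1+mersenne
  ; factorialOver; t*factorialOver≡; unique-length-≤; residues; residues-unique; ∈-residues⁻
  ; Parameters; parameters; deficit; 1≤deficit; few-missing; many-residues )

-- Fractions of natural numbers in ℚ

toℚᵘ-/ : ∀ a k → ℚ.toℚᵘ (+ a / suc k) ℚᵘ.≃ ℚᵘ.mkℚᵘ (+ a) k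
toℚᵘ-/ a k = ℚₚ.toℚᵘ-fromℚᵘ (ℚᵘ.mkℚᵘ (+ a) k)

/-mono-≤ : ∀ {a b k l} → a ℕ.* suc l ℕ.≤ b ℕ.* suc k → + a / suc k ℚ.≤ + b / suc l
/-mono-≤ {a} {b} {k} {l} le = ℚₚ.toℚᵘ-cancel-≤
  (ℚᵘₚ.≤-trans (ℚᵘₚ.≤-reflexive (toℚᵘ-/ a k))
  (ℚᵘₚ.≤-trans (ℚᵘ.*≤* (subst₂ ℤ._≤_ (ℤₚ.pos-* a (suc l)) (ℤₚ.pos-* b (suc k)) (ℤ.+≤+ le)))
  (ℚᵘₚ.≤-reflexive (ℚᵘₚ.≃-sym (toℚᵘ-/ b l)))))

/-mono-< : ∀ {a b k l} → a ℕ.* suc l ℕ.< b ℕ.* suc k → + a / suc k ℚ.< + b / suc l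
/-mono-< {a} {b} {k} {l} lt = ℚₚ.toℚᵘ-cancel-<
  (ℚᵘₚ.≤-<-trans (ℚᵘₚ.≤-reflexive (toℚᵘ-/ a k))
  (ℚᵘₚ.<-≤-trans (ℚᵘ.*<* (subst₂ ℤ._<_ (ℤₚ.pos-* a (suc l)) (ℤₚ.pos-* b (suc k)) (ℤ.+<+ lt)))
  (ℚᵘₚ.≤-reflexive (ℚᵘₚ.≃-sym (toℚᵘ-/ b l)))))

/-homo-+ : ∀ a b k → + (a ℕ.+ b) / suc k ≡ + a / suc k ℚ.+ + b / suc k
/-homo-+ a b k = sym (ℚₚ.toℚᵘ-injective
  (ℚᵘₚ.≃-trans (ℚₚ.toℚᵘ-homo-+ (+ a / suc k) (+ b / suc k))
  (ℚᵘₚ.≃-trans (ℚᵘₚ.+-cong (toℚᵘ-/ a k) (toℚᵘ-/ b k))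
  (ℚᵘₚ.≃-trans (ℚᵘ.*≡* cross) (ℚᵘₚ.≃-sym (toℚᵘ-/ (a ℕ.+ b) k))))))
  where
  ring : ∀ a b n → (a ℕ.* n ℕ.+ b ℕ.* n) ℕ.* n ≡ (a ℕ.+ b) ℕ.* (n ℕ.* n)
  ring = solve-∀
  n = suc k
  cross : (+ a ℤ.* + n ℤ.+ + b ℤ.* + n) ℤ.* + n ≡ + (a ℕ.+ b) ℤ.* + (n ℕ.* n)
  cross = trans (cong (ℤ._* + n) (trans (cong₂ ℤ._+_ (sym (ℤₚ.pos-* a n)) (sym (ℤₚ.pos-* b n)))
      (sym (ℤₚ.pos-+ (a ℕ.* n) (b ℕ.* n)))))
    (trans (sym (ℤₚ.pos-* (a ℕ.* n ℕ.+ b ℕ.* n) n))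
    (trans (cong +_ (ring a b n)) (ℤₚ.pos-* (a ℕ.+ b) (n ℕ.* n))))

fromℕ-+ : ∀ a b → fromℕ (a ℕ.+ b) ≡ fromℕ a ℚ.+ fromℕ b
fromℕ-+ a b = /-homo-+ a b 0

fromℕ-* : ∀ a b → fromℕ (a ℕ.* b) ≡ fromℕ a ℚ.* fromℕ b
fromℕ-* a b = sym (ℚₚ.toℚᵘ-injective
  (ℚᵘₚ.≃-trans (ℚₚ.toℚᵘ-homo-* (fromℕ a) (fromℕ b))
  (ℚᵘₚ.≃-trans (ℚᵘₚ.*-cong (toℚᵘ-/ a 0) (toℚᵘ-/ b 0))
  (ℚᵘₚ.≃-trans (ℚᵘ.*≡* (cong (ℤ._* + 1) (sym (ℤₚ.pos-* a b))))
  (ℚᵘₚ.≃-sym (toℚᵘ-/ (a ℕ.* b) 0))))))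

fromℕ-^ : ∀ a n → fromℕ (a ℕ.^ n) ≡ fromℕ a ^ℚ n
fromℕ-^ a zero    = refl
fromℕ-^ a (suc n) = trans (fromℕ-* a (a ℕ.^ n)) (cong (fromℕ a ℚ.*_) (fromℕ-^ a n))

fromℕ-mono-≤ : ∀ {a b} → a ℕ.≤ b → fromℕ a ℚ.≤ fromℕ b
fromℕ-mono-≤ {a} {b} a≤b = /-mono-≤ {a} {b} {0} {0} (ℕₚ.*-monoˡ-≤ 1 a≤b)

fromℕ-mono-< : ∀ {a b} → a ℕ.< b → fromℕ a ℚ.< fromℕ b
fromℕ-mono-< {a} {b} a<b = /-mono-< {a} {b} {0} {0} (ℕₚ.*-monoˡ-< 1 a<b)

0≤fromℕ : ∀ a → 0ℚ ℚ.≤ fromℕ a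
0≤fromℕ a = fromℕ-mono-≤ {0} {a} z≤n

-- Integers below the threshold

-- The fraction k / (2k + 1), built by `mkℚ` so that the numerator and denominator read off by
-- `InPower` are exactly k and 2k + 1.
halfBelow : ℕ → ℚ
halfBelow k = mkℚ (+ k) (2 ℕ.* k) coprime
  where
  coprime : Coprime k (suc (2 ℕ.* k))
  coprime {d} (d∣k , d∣1+2k) = ∣1⇒≡1 (∣m+n∣m⇒∣n
    (subst (d ∣_) (ℕₚ.+-comm 1 (2 ℕ.* k)) d∣1+2k) (∣n⇒∣m*n 2 d∣k))

halfBelow<½ : ∀ k → halfBelow k ℚ.< ½
halfBelow<½ k = *<* (subst₂ ℤ._<_ (ℤₚ.pos-* k 2) (ℤₚ.pos-* 1 (suc (2 ℕ.* k)))
  (ℤ.+<+ (subst (k ℕ.* 2 ℕ.<_) (sym (ℕₚ.*-identityˡ (suc (2 ℕ.* k))))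
    (s≤s (ℕₚ.≤-reflexive (ℕₚ.*-comm k 2))))))

-- With k = h + 1, the exponent k / (2 k + 1) < ½ is so close to ½ that m ^ (k / (2 k + 1)) ≥ k.
∈-sqrt : ∀ {h m} → 2 ℕ.* (suc h ℕ.* suc h) ℕ.≤ m →
  fromℕ h ∈ fromℚ (fromℕ (suc m)) ^ fromℚ ½
∈-sqrt {h} {m} 2cc≤m = inj₂ record
  -- The base has to lie strictly below p = m + 1.
  { b      = fromℕ m
  ; c      = fromℕ k
  ; t      = halfBelow k
  ; 0<b    = fromℕ-mono-< {0} {m} 1≤m
  ; b∈α    = fromℕ-mono-< {m} {suc m} ℕₚ.≤-refl
  ; 0≤t    = *≤* (ℤ.+≤+ z≤n)
  ; t-side = inj₁ (fromℕ-mono-≤ {1} {m} 1≤m , halfBelow<½ k)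
  ; 0≤c    = 0≤fromℕ k
  ; c≤b^t  = subst₂ ℚ._≤_ (fromℕ-^ k (suc (2 ℕ.* k))) (fromℕ-^ m k)
               (fromℕ-mono-≤ (power-bound {k} {m} k (ℕₚ.<⇒≤ (n<2^n k)) 2cc≤m))
  ; q<c    = fromℕ-mono-< {h} {k} ℕₚ.≤-refl
  }
  where
  k = suc h
  1≤m : 1 ℕ.≤ m
  1≤m = ℕₚ.≤-trans (s≤s z≤n) 2cc≤m

sum-interval-≤ : ∀ {n} a D (g : ℕ → ℕ) (f : Fin n → ℚ) →
  (∀ i → + g (a ℕ.+ toℕ i) / suc D ℚ.≤ f i) → + ∑ (interval a n) g / suc D ℚ.≤ sumℚ f
sum-interval-≤ {zero}  a D g f g≤f = ℚₚ.≤-reflexive (ℚₚ.0/n≡0 (suc D))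
sum-interval-≤ {suc n} a D g f g≤f = ℚₚ.≤-trans
  (ℚₚ.≤-reflexive (/-homo-+ (g a) (∑ (interval (suc a) n) g) D))
  (ℚₚ.+-mono-≤ (subst (λ b → + g b / suc D ℚ.≤ f fzero) (ℕₚ.+-identityʳ a) (g≤f fzero))
    (sum-interval-≤ (suc a) D g (f ∘ fsuc)
      (λ i → subst (λ b → + g b / suc D ℚ.≤ f (fsuc i)) (ℕₚ.+-suc a (toℕ i)) (g≤f (fsuc i)))))

-- With unit steps the lower sum is 1 / 2 + ⋯ + 1 / (m + 1).
lowerSum-≥ : ∀ k D (g : ℕ → ℕ) → (∀ {t} → 1 ℕ.≤ t → t ℕ.≤ suc (suc k) → t ℕ.* g t ≡ suc D) →
  + ∑ (interval 2 (suc k)) g / suc D ℚ.≤ lowerSum (suc k) k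
lowerSum-≥ k D g t*gt≡D = sum-interval-≤ 2 D g _ λ i →
  /-mono-≤ {g (2 ℕ.+ toℕ i)} {suc k} {D} {_} (ℕₚ.≤-reflexive
    (trans (ring (g (2 ℕ.+ toℕ i)) (suc k) (toℕ i))
      (cong (suc k ℕ.*_) (t*gt≡D (s≤s z≤n) (s≤s (s≤s (toℕ≤pred[n] i)))))))
  where
  ring : ∀ g m i → g ℕ.* (m ℕ.+ suc i ℕ.* m) ≡ m ℕ.* (suc (suc i) ℕ.* g)
  ring = solve-∀

-- Unit steps give 1/2 + ⋯ + 1/n, in which each of e = 2 (B + 1) dyadic blocks contributes at least
-- 1/2. The total is at least B + 1 > B.
∈-log : ∀ {B m} → 2 ℕ.^ (2 ℕ.* suc B) ℕ.≤ suc m → fromℕ B ∈ log (suc m)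
∈-log {B} {zero}  2^≤ = contradiction 2^≤ (ℕₚ.<⇒≱ (ℕₚ.≤-trans (s≤s (s≤s z≤n)) (n<2^n (2 ℕ.* suc B))))
∈-log {B} {suc k} 2^≤ = above (ℕ.pred (n !)) (sym (ℕₚ.suc-pred (n !) {{n !≢0}}))
  where
  n = suc (suc k)
  e = 2 ℕ.* suc B
  g = factorialOver n
  S = ∑ (interval 2 (suc k)) g
  above : ∀ D → n ! ≡ suc D → fromℕ B ∈ log n
  above D n!≡ = k , ℚₚ.<-≤-trans (/-mono-< {B} {S} {0} {D} B*n!<S)
    (lowerSum-≥ k D g (λ 1≤t t≤ → trans (t*factorialOver≡ 1≤t t≤) n!≡))
    where
    open ℕₚ.≤-Reasoning
    mersenne≤ : mersenne e ℕ.≤ suc k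
    mersenne≤ = ℕ.s≤s⁻¹ (ℕₚ.≤-trans (ℕₚ.≤-reflexive (1+mersenne e)) 2^≤)
    B*n!<S : B ℕ.* suc D ℕ.< S ℕ.* 1
    B*n!<S = ℕₚ.*-cancelˡ-< 2 _ _ (begin-strict
      2 ℕ.* (B ℕ.* suc D)            <⟨ ℕₚ.*-monoʳ-< 2 (ℕₚ.*-monoˡ-< (suc D) (ℕₚ.n<1+n B)) ⟩
      2 ℕ.* (suc B ℕ.* suc D)        ≡⟨ ℕₚ.*-assoc 2 (suc B) (suc D) ⟨
      e ℕ.* suc D                    ≤⟨ harmonic-lower {suc D} g e (λ 1≤t t≤ → ℕₚ.≤-reflexive
                                          (sym (trans (t*factorialOver≡ 1≤t (ℕₚ.≤-trans t≤ 2^≤)) n!≡))) ⟩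
      2 ℕ.* ∑ (interval 2 (mersenne e)) g  ≤⟨ ℕₚ.*-monoʳ-≤ 2 (∑-interval-mono 2 g mersenne≤) ⟩
      2 ℕ.* S                        ≡⟨ cong (2 ℕ.*_) (ℕₚ.*-identityʳ S) ⟨
      2 ℕ.* (S ℕ.* 1)                ∎)

-- The cut of 2 does not contain 2, so a positive element of ε must make up for an r < 2. Positivity
-- of ε yields only some q ≥ 0 in it; roundedness supplies q′ > 0, and then r is chosen between 2 -
-- q′ and 2.
2∈2+ε : ∀ {ε} → 0ℝ < ε → fromℕ 2 ∈ fromℚ (fromℕ 2) + ε
2∈2+ε {ε} (q , q∈ε , q≮0) with ℝ.rounded ε q∈ε
... | q′ , q<q′ , q′∈ε with ℚₚ.<-dense 2-q′<2
  where
  2-q′<2 : fromℕ 2 ℚ.- q′ ℚ.< fromℕ 2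
  2-q′<2 = subst (fromℕ 2 ℚ.- q′ ℚ.<_) (ℚₚ.+-identityʳ (fromℕ 2))
    (ℚₚ.+-monoʳ-< (fromℕ 2) (ℚₚ.neg-antimono-< (ℚₚ.≤-<-trans (ℚₚ.≮⇒≥ q≮0) q<q′)))
... | r , 2-q′<r , r<2 = r , q′ , r<2 , q′∈ε ,
  subst (ℚ._< r ℚ.+ q′) (trans (ℚₚ.+-assoc (fromℕ 2) (ℚ.- q′) q′)
    (trans (cong (fromℕ 2 ℚ.+_) (ℚₚ.+-inverseˡ q′)) (ℚₚ.+-identityʳ (fromℕ 2))))
    (ℚₚ.+-monoˡ-< q′ 2-q′<r)

-- Base B and exponent 2 certify everything below B², and B < B² because B ≥ 2.
∈-log^2+ε : ∀ {ε B m} → 0ℝ < ε → 2 ℕ.≤ B → 2 ℕ.^ (2 ℕ.* suc B) ℕ.≤ suc m →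
  fromℕ B ∈ log (suc m) ^ (fromℚ (fromℕ 2) + ε)
∈-log^2+ε {ε} {B} {m} 0<ε 2≤B 2^≤ = inj₂ record
  { b      = fromℕ B
  ; c      = fromℕ (B ℕ.* B)
  ; t      = fromℕ 2
  ; 0<b    = fromℕ-mono-< {0} {B} 1≤B
  ; b∈α    = ∈-log {B} {m} 2^≤
  ; 0≤t    = *≤* (ℤ.+≤+ z≤n)
  ; t-side = inj₁ (fromℕ-mono-≤ {1} {B} 1≤B , 2∈2+ε {ε} 0<ε)
  ; 0≤c    = 0≤fromℕ (B ℕ.* B)
  ; c≤b^t  = ℚₚ.≤-reflexive (trans (ℚₚ.*-identityʳ _) (trans (fromℕ-* B B)
               (cong (fromℕ B ℚ.*_) (sym (ℚₚ.*-identityʳ (fromℕ B))))))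
  ; q<c    = fromℕ-mono-< {B} {B ℕ.* B} (ℕₚ.<-≤-trans
               (ℕₚ.m<m*n B 2 {{ℕ.>-nonZero 1≤B}} (s≤s (s≤s z≤n))) (ℕₚ.*-monoʳ-≤ B 2≤B))
  }
  where
  1≤B : 1 ℕ.≤ B
  1≤B = ℕₚ.≤-trans (s≤s z≤n) 2≤B

≤-threshold : ∀ {ε B h m x} → 0ℝ < ε → 2 ℕ.≤ B → 2 ℕ.^ (2 ℕ.* suc B) ℕ.≤ suc m →
  2 ℕ.* (suc h ℕ.* suc h) ℕ.≤ m → x ℕ.≤ h ℕ.* B → fromℚ (fromℕ x) ≤ threshold ε (suc m)
≤-threshold {ε} {B} {h} {m} {x} 0<ε 2≤B 2^≤ 2hh≤ x≤ q<x = inj₂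
  ( fromℕ h , fromℕ B , ∈-sqrt {h} {m} 2hh≤ , ∈-log^2+ε {ε} {B} {m} 0<ε 2≤B 2^≤ , 0≤fromℕ h , 0≤fromℕ B
  , ℚₚ.<-≤-trans q<x (ℚₚ.≤-trans (fromℕ-mono-≤ {x} {h ℕ.* B} x≤) (ℚₚ.≤-reflexive (fromℕ-* h B))))

-- Counting up to the tolerance δ

-- A positive fraction has numerator at least 1. Thus `↧ₙ δ` serves as the integer b with 1 / b ≤ δ.
1/↧ₙ≤ : ∀ δ → 0ℚ ℚ.< δ → + 1 / ↧ₙ δ ℚ.≤ δ
1/↧ₙ≤ (mkℚ (+ suc a) d _) _ = ℚₚ.toℚᵘ-cancel-≤ (ℚᵘₚ.≤-trans (ℚᵘₚ.≤-reflexive (toℚᵘ-/ 1 d))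
  (ℚᵘ.*≤* (ℤₚ.*-monoʳ-≤-nonNeg (+ suc d) (ℤ.+≤+ (s≤s (z≤n {a}))))))
1/↧ₙ≤ (mkℚ (+ zero) d _) (*<* (ℤ.+<+ ()))
1/↧ₙ≤ (mkℚ -[1+ a ] d _) (*<* ())

1/-* : ∀ d a → (+ 1 / suc d) ℚ.* fromℕ a ≡ + a / suc d
1/-* d a = ℚₚ.toℚᵘ-injective
  (ℚᵘₚ.≃-trans (ℚₚ.toℚᵘ-homo-* (+ 1 / suc d) (fromℕ a))
  (ℚᵘₚ.≃-trans (ℚᵘₚ.*-cong (toℚᵘ-/ 1 d) (toℚᵘ-/ a 0))
  (ℚᵘₚ.≃-trans (ℚᵘ.*≡* (cong₂ ℤ._*_ (ℤₚ.*-identityˡ (+ a)) (cong +_ (sym (ℕₚ.*-identityʳ (suc d))))))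
  (ℚᵘₚ.≃-sym (toℚᵘ-/ a d)))))

≤δ* : ∀ δ → 0ℚ ℚ.< δ → ∀ {r p} → ↧ₙ δ ℕ.* r ℕ.≤ p → fromℕ r ℚ.≤ δ ℚ.* fromℕ p
≤δ* δ@(mkℚ _ d _) 0<δ {r} {p} br≤p = ℚₚ.≤-trans
  (/-mono-≤ {r} {p} {0} {d} (ℕₚ.≤-trans (ℕₚ.≤-reflexive (ℕₚ.*-comm r (suc d)))
    (ℕₚ.≤-trans br≤p (ℕₚ.≤-reflexive (sym (ℕₚ.*-identityʳ p))))))
  (ℚₚ.≤-trans (ℚₚ.≤-reflexive (sym (1/-* d p)))
    (ℚₚ.*-monoʳ-≤-nonNeg (fromℕ p) {{ℚ.nonNegative (0≤fromℕ p)}} (1/↧ₙ≤ δ 0<δ)))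

[1-δ]*≤ : ∀ δ → 0ℚ ℚ.< δ → ∀ {n p} → n ℕ.≤ p → ↧ₙ δ ℕ.* (p ℕ.∸ n) ℕ.≤ p →
  (1ℚ ℚ.- δ) ℚ.* fromℕ p ℚ.≤ fromℕ n
[1-δ]*≤ δ 0<δ {n} {p} n≤p le = begin
  (1ℚ ℚ.- δ) ℚ.* P                    ≡⟨ ℚₚ.*-distribʳ-+ P 1ℚ (ℚ.- δ) ⟩
  1ℚ ℚ.* P ℚ.+ (ℚ.- δ) ℚ.* P          ≡⟨ cong₂ ℚ._+_ (ℚₚ.*-identityˡ P) (sym (ℚₚ.neg-distribˡ-* δ P)) ⟩
  P ℚ.- δ ℚ.* P                       ≤⟨ ℚₚ.+-monoʳ-≤ P (ℚₚ.neg-antimono-≤ (≤δ* δ 0<δ le)) ⟩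
  P ℚ.- fromℕ (p ℕ.∸ n)               ≡⟨ cong (ℚ._- fromℕ (p ℕ.∸ n)) split ⟩
  fromℕ n ℚ.+ fromℕ (p ℕ.∸ n) ℚ.- fromℕ (p ℕ.∸ n)  ≡⟨ ℚₚ.+-assoc (fromℕ n) _ _ ⟩
  fromℕ n ℚ.+ (fromℕ (p ℕ.∸ n) ℚ.- fromℕ (p ℕ.∸ n))
    ≡⟨ cong (fromℕ n ℚ.+_) (ℚₚ.+-inverseʳ (fromℕ (p ℕ.∸ n))) ⟩
  fromℕ n ℚ.+ 0ℚ                      ≡⟨ ℚₚ.+-identityʳ (fromℕ n) ⟩
  fromℕ n                             ∎
  where
  open ℚₚ.≤-Reasoning
  P = fromℕ p
  split : P ≡ fromℕ n ℚ.+ fromℕ (p ℕ.∸ n)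
  split = trans (cong fromℕ (sym (ℕₚ.m+[n∸m]≡n n≤p))) (fromℕ-+ n (p ℕ.∸ n))

Products-≥ : ∀ {ε} → 0ℝ < ε → ∀ {δ} → 0ℚ ℚ.< δ → ∀ {B₀ p} .{{_ : NonZero p}} → Prime p →
  deficit ℕ.* ↧ₙ δ ℕ.≤ B₀ → Parameters B₀ p →
  (1ℚ ℚ.- δ) ℚ.* fromℕ p ≤# Products p (threshold ε p)
Products-≥ {ε} 0<ε {δ} 0<δ {B₀} {p@(suc m)} pr Kb≤B₀ ps =
  residues p N , residues-unique p N , tabulate member ,
  [1-δ]*≤ δ 0<δ n≤p (ℕₚ.≤-trans
    (few-missing {↧ₙ δ} {B} {deficit} {n} {p ℕ.∸ n} 1≤deficit (ℕₚ.≤-trans Kb≤B₀ B₀≤B)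
      (subst (λ k → B ℕ.* k ℕ.≤ n ℕ.* (B ℕ.+ deficit)) (sym (ℕₚ.m+[n∸m]≡n n≤p)) (many-residues pr ps)))
    n≤p)
  where
  open Parameters ps
  N = h ℕ.* B
  n = length (residues p N)
  n≤p : n ℕ.≤ p
  n≤p = unique-length-≤ (residues-unique p N)
  small : ∀ {x} → x ℕ.≤ N → fromℚ (fromℕ x) ≤ threshold ε p
  small {x} = ≤-threshold {ε} {B} {h} {m} {x} 0<ε (ℕₚ.≤-trans (ℕₚ.n≤1+n 2) 3≤B) 4^B≤p (ℕ.s≤s⁻¹ hh<p)
  member : ∀ {a} → _ → Products p (threshold ε p) a
  member a∈ with ∈-residues⁻ p N a∈
  ... | (x , y) , z∈ , a≡ = let (1≤x , x≤) , (1≤y , y≤) = ∈-square⁻ z∈ in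
    x , y , 1≤x , (λ {q} → small x≤ {q}) , 1≤y , (λ {q} → small y≤ {q}) , sym a≡

#≤[1+δ]* : ∀ {δ} → 0ℚ ℚ.< δ → ∀ {p} (S : Fin p → Set) → S #≤ (1ℚ ℚ.+ δ) ℚ.* fromℕ p
#≤[1+δ]* {δ} 0<δ {p} S as u _ = begin
  fromℕ (length as)            ≤⟨ fromℕ-mono-≤ (unique-length-≤ u) ⟩
  fromℕ p                      ≡⟨ ℚₚ.*-identityˡ (fromℕ p) ⟨
  1ℚ ℚ.* fromℕ p               ≤⟨ ℚₚ.*-monoʳ-≤-nonNeg (fromℕ p) {{ℚ.nonNegative (0≤fromℕ p)}} 1≤1+δ ⟩
  (1ℚ ℚ.+ δ) ℚ.* fromℕ p       ∎
  where
  open ℚₚ.≤-Reasoning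
  1≤1+δ : 1ℚ ℚ.≤ 1ℚ ℚ.+ δ
  1≤1+δ = ℚₚ.≤-trans (ℚₚ.≤-reflexive (sym (ℚₚ.+-identityʳ 1ℚ))) (ℚₚ.+-monoʳ-≤ 1ℚ (ℚₚ.<⇒≤ 0<δ))

corollary5 : (ε : ℝ) → 0ℝ < ε →
    (δ : ℚ) → 0ℚ ℚ.< δ →
    ∃[ P ] ((p : ℕ) .{{_ : NonZero p}} → Prime p → P ℕ.≤ p →
    ((1ℚ ℚ.- δ) ℚ.* fromℕ p ≤# Products p (threshold ε p)) ×
    (Products p (threshold ε p) #≤ (1ℚ ℚ.+ δ) ℚ.* fromℕ p))
corollary5 ε 0<ε δ 0<δ = 2 ℕ.^ (2 ℕ.* suc B₀) , λ p pr P≤p →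
  Products-≥ {ε} 0<ε {δ} 0<δ pr (ℕₚ.m≤n+m (deficit ℕ.* ↧ₙ δ) 3) (parameters B₀ (ℕₚ.m≤m+n 3 _) P≤p) ,
  #≤[1+δ]* 0<δ (Products p (threshold ε p))
  where
  -- The summand `deficit` · `↧ₙ δ` makes `deficit` / B at most 1 / `↧ₙ δ` ≤ δ, and 3 meets the
  -- requirement 3 ≤ B. Primes from 4^(B₀ + 1) on have B ≥ B₀.
  B₀ = 3 ℕ.+ deficit ℕ.* ↧ₙ δ
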